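{- Let $q$ be a prime power. For all positive integers $d,t$ with $d<q$ and $t+1<q$, an optimum $(d,t)$-CDA$((d+1)q^t;q+t-1,q)$ exists. Moreover, if $q\ge4$ is a power of $2$, then an optimum $(d,2)$-CDA$((d+1)q^2;2q+3,q)$ exists for every positive integer $d<q$.
   Context: Consecutive $t$-way interaction in an $N\times k$ array $A=(a_{ij})$ over a $v$-set $V$: $T=\{(i,x_i),\dots,(i+t-1,x_{i+t-1})\}$, $1\le i\le k-t+1$, $x_r\in V$; $\rho(A,T)=\{r: a_{r,j}=x_j\ \forall (j,x_j)\in T\}$, $\rho(A,\mathcal T)=\bigcup_{T\in\mathcal T}\rho(A,T)$. A $(d,t)$-CDA$(N;k,v)$ is an $N\times k$ array over $V$ in which every $t$ consecutive columns contain every $t$-tuple at least once, and such that for every set $\mathcal T$ of exactly $d$ distinct consecutive $t$-way interactions and every consecutive $t$-way interaction $T$: $\rho(A,T)\subseteq\rho(A,\mathcal T)$ iff $T\in\mathcal T$. It is optimum if $N=(d+1)v^t$. -}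

module Defs where

open import Data.Fin.Base using (Fin; toℕ; fromℕ<)
open import Data.Fin.Properties using (toℕ<n)
open import Data.List.Base using (List; length)
open import Data.List.Membership.Propositional using () renaming (_∈_ to _∈ˡ_)
open import Data.List.Relation.Unary.Unique.Propositional using (Unique)
open import Data.Nat.Base using (ℕ; suc; _+_; _*_; _∸_; _^_; _≤_; _<_)
open import Data.Nat.Primality using (Prime)
open import Data.Nat.Properties using (≤-trans; <-≤-trans; <⇒≤; +-monoʳ-<; +-monoˡ-≤; m∸n≢0⇒n<m; m∸n+n≡m; ≤-reflexive; ≤-pred)
open import Data.Product.Base using (Σ-syntax; ∃-syntax; _×_)
open import Data.Vec.Base using (Vec; lookup)
open import Function.Bundles using (_⇔_)
open import Level using (0ℓ)
open import Relation.Binary.PropositionalEquality.Core using (_≡_; _≢_; refl)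
open import Relation.Unary using (Pred; _∈_; _⊆_)

IsPrimePower : ℕ → Set
IsPrimePower q = ∃[ p ] ∃[ e ] (Prime p × 1 ≤ e × q ≡ p ^ e)

IsPowerOf2 : ℕ → Set
IsPowerOf2 q = ∃[ e ] (q ≡ 2 ^ e)

-- N × k arrays over the v-set V = Fin v.
Array : (N k v : ℕ) → Set
Array N k v = Fin N → Fin k → Fin v

-- The interaction {(i , x_i), …, (i+t-1 , x_{i+t-1})} is given by its first
-- column and its tuple of values.  Columns are numbered from 0, so the first
-- column ranges over the k - t + 1 numbers i with i + t ≤ k (there are none
-- when t > k).  For t ≥ 1, distinct records are distinct sets of pairs.
record Interaction (k v t : ℕ) : Set where
  constructor interaction
  field
    start  : Fin (suc k ∸ t)
    values : Vec (Fin v) t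

open Interaction public

start+t≤k : ∀ (k t : ℕ) (i : Fin (suc k ∸ t)) → toℕ i + t ≤ k
start+t≤k k t i = ≤-pred (≤-trans (+-monoˡ-≤ t (toℕ<n i)) (≤-reflexive (m∸n+n≡m (<⇒≤ t<1+k))))
  where
  nonempty : ∀ {n} → Fin n → n ≢ 0
  nonempty () refl
  t<1+k : t < suc k
  t<1+k = m∸n≢0⇒n<m (nonempty i)

column : ∀ {k t : ℕ} → Fin (suc k ∸ t) → Fin t → Fin k
column {k} {t} i j = fromℕ< (<-≤-trans (+-monoʳ-< (toℕ i) (toℕ<n j)) (start+t≤k k t i))

module _ {N k v t : ℕ} where

  ρ : Array N k v → Interaction k v t → Pred (Fin N) 0ℓ
  ρ A T r = ∀ (j : Fin t) → A r (column (start T) j) ≡ lookup (values T) j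

  ρ⋃ : Array N k v → List (Interaction k v t) → Pred (Fin N) 0ℓ
  ρ⋃ A 𝒯 r = ∃[ T ] (T ∈ˡ 𝒯 × r ∈ ρ A T)

-- A set of exactly d interactions is a duplicate-free list of length d.
record IsCDA (d t : ℕ) {N k v : ℕ} (A : Array N k v) : Set where
  field
    covering  : ∀ (i : Fin (suc k ∸ t)) (x : Vec (Fin v) t) →
                ∃[ r ] (r ∈ ρ A (interaction i x))
    detecting : ∀ (𝒯 : List (Interaction k v t)) → Unique 𝒯 → length 𝒯 ≡ d →
                ∀ (T : Interaction k v t) → (ρ A T ⊆ ρ⋃ A 𝒯) ⇔ (T ∈ˡ 𝒯)

CDA : (d t N k v : ℕ) → Set
CDA d t N k v = Σ[ A ∈ Array N k v ] IsCDA d t A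

OptimumCDA : (d t N k v : ℕ) → Set
OptimumCDA d t N k v = CDA d t N k v × N ≡ (d + 1) * v ^ t

{-# OPTIONS --safe #-}
module Submission where

open import Algebra.Bundles using (CommutativeRing; RawRing)
import Algebra.Morphism.RingMonomorphism
import Algebra.Morphism.Structures
import Algebra.Properties.AbelianGroup
import Algebra.Properties.CommutativeMonoid.Sum
import Algebra.Properties.CommutativeSemigroup
import Algebra.Properties.CommutativeSemiring.Binomial
import Algebra.Properties.Monoid.Sum
import Algebra.Properties.Ring
import Algebra.Properties.Semiring.Exp
import Algebra.Properties.Semiring.Mult
import Algebra.Properties.Semiring.Sum
import Algebra.Solver.Ring
open import Algebra.Solver.Ring.AlmostCommutativeRing using (fromCommutativeRing; _-Raw-AlmostCommutative⟶_)
open import Algebra.Structures using (IsCommutativeRing)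
open import Data.Bool.Base using (if_then_else_)
open import Data.Fin.Base using (Fin; zero; suc; toℕ; fromℕ; inject₁; fromℕ<; combine; remQuot; finToFun; funToFin; punchOut; inject≤)
open import Data.Fin.Properties using (toℕ-fromℕ; toℕ-inject₁; toℕ<n; toℕ-fromℕ<; toℕ-injective; all?; any?; pigeonhole; punchOut-injective; injective⇒≤; remQuot-combine; funToFin-finToFin; finToFun-funToFin; inject≤-injective; <⇒≢) renaming (_≟_ to _≟ᶠ_)
open import Data.List.Base using (List; []; _∷_; _++_; map; [_]; cartesianProductWith; allFin; length; lookup)
open import Data.List.Membership.Propositional using (_∈_)
open import Data.List.Membership.Propositional.Properties using (∈-map⁺; ∈-++⁺ˡ; ∈-++⁺ʳ; ∈-cartesianProductWith⁺; ∈-allFin)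
open import Data.List.Relation.Unary.All using (All; []; _∷_) renaming (lookup to All-lookup)
open import Data.List.Relation.Unary.Any using (here; there; index) renaming (any? to any?ˡ)
open import Data.List.Relation.Unary.Any.Properties using (lookup-index)
open import Data.Maybe.Base using (Maybe; just; nothing)
open import Data.Nat.Base as ℕ using (ℕ; zero; suc; z≤n; s≤s; NonZero; ⌊_/2⌋)
open import Data.Nat.Combinatorics using (_C_; nCn≡1; nCk+nC[k+1]≡[n+1]C[k+1]; k>n⇒nCk≡0; nC1≡n)
open import Data.Nat.DivMod using (_%_; %-distribˡ-+; %-distribˡ-*; m<n⇒m%n≡m; m*n%n≡0; _/_; m≡m%n+[m/n]*n; m%n<n; _mod_; [m+n]%n≡m%n; [m+kn]%n≡m%n; m<n*o⇒m/o<n)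
open import Data.Nat.Divisibility as ℕ using (divides; ∣⇒≤; m∣m*n)
open import Data.Nat.Primality using (Prime; euclidsLemma; prime⇒nonTrivial; prime⇒nonZero)
import Data.Nat.Properties as ℕ
open import Data.Product.Base using (_×_; _,_; proj₁; proj₂; ∃-syntax)
open import Data.Sum.Base using (_⊎_; inj₁; inj₂)
import Data.Vec.Base as Vec
import Data.Vec.Properties as Vec
open import Defs
open import Function.Base using (_∘_)
open import Function.Bundles using (mk⇔)
open import Level using (0ℓ)
open import Relation.Binary.Definitions using (Decidable; tri<; tri≈; tri>)
open import Relation.Binary.PropositionalEquality.Core as ≡ using (_≡_; _≢_)
import Relation.Binary.PropositionalEquality.Properties as ≡
import Relation.Binary.Reasoning.Setoid
open import Relation.Nullary using (Dec; yes; no; ¬_; contradiction; does)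
open import Relation.Nullary.Decidable using (map′; dec-true; dec-false; _×-dec_)

-- Call c ∈ D, |D| = d + 1, the block of a row.  It suffices that for every c the rows of block c
-- show each tuple exactly once in each window of t consecutive columns, and that two rows of
-- different blocks never agree on two windows: the d + 1 rows containing an interaction T lie
-- in distinct blocks, so any other interaction contains at most one of them.
--
-- For the first part the rows are the polynomials of degree at most t over 𝔽_q with leading
-- coefficient c ∈ D, evaluated at the q points in cyclic order: two different windows of t < q
-- cyclically consecutive points contain at least t + 1 points.  For the second part the rows are
-- vectors (c , a , b), and the columns are linear forms: the l-th one vanishes at (1 , u_l) and
-- (1 , u_{l+1}), where u_0, u_1, … are distinct points of the affine plane, no three consecutive
-- ones collinear.  The l-th window then determines (a , b) - c u_{l+1} up to an invertible map.
--
-- A field with q = p^e elements is obtained from ℤ/p by adjoining q times a universal solution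
-- of x^q = x.  All elements of the resulting ring satisfy x^q = x, and the Vandermonde determinant
-- of the q adjoined elements is nonzero, since each step multiplies it by a monic polynomial of
-- degree < q in the new variable.  Some nonzero idempotent e below a power of the determinant
-- makes each of finitely many given elements zero or invertible in the corner eR.  There the q adjoined
-- elements are distinct, and they are closed under the ring operations because x^q - x, having
-- these q roots, has no others.

-- Solving ring identities with integer coefficients.

-- The coefficient (m , n) stands for the integer m - n.
module IntegerCoefficientSolver (R : CommutativeRing 0ℓ 0ℓ) where
  open CommutativeRing R hiding (zero)
  open Algebra.Properties.AbelianGroup +-abelianGroup using (⁻¹-∙-comm; ε⁻¹≈ε; ⁻¹-involutive)
  open Algebra.Properties.CommutativeSemigroup +-commutativeSemigroup using (interchange)
  open Algebra.Properties.Ring ring using (-‿distribˡ-*; -‿distribʳ-*)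
  open Algebra.Properties.Semiring.Mult semiring using (×-homo-+; ×1-homo-*; ×-congˡ) renaming (_×_ to _·_)
  open Relation.Binary.Reasoning.Setoid setoid

  differences : RawRing 0ℓ 0ℓ
  differences = record
    { Carrier = ℕ × ℕ
    ; _≈_     = _≡_
    ; _+_     = λ (m , n) (m′ , n′) → m ℕ.+ m′ , n ℕ.+ n′
    ; _*_     = λ (m , n) (m′ , n′) → m ℕ.* m′ ℕ.+ n ℕ.* n′ , m ℕ.* n′ ℕ.+ n ℕ.* m′
    ; -_      = λ (m , n) → n , m
    ; 0#      = 0 , 0
    ; 1#      = 1 , 0
    }

  *-expand-differences : ∀ a b a′ b′ → (a * a′ + b * b′) - (a * b′ + b * a′) ≈ (a - b) * (a′ - b′)
  *-expand-differences a b a′ b′ = begin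
    (a * a′ + b * b′) - (a * b′ + b * a′)           ≈⟨ +-congˡ (⁻¹-∙-comm _ _) ⟨
    (a * a′ + b * b′) + (- (a * b′) + - (b * a′))   ≈⟨ interchange _ _ _ _ ⟩
    (a * a′ + - (a * b′)) + (b * b′ + - (b * a′))   ≈⟨ +-cong (+-congˡ (-‿distribʳ-* a b′)) (+-comm _ _) ⟩
    (a * a′ + a * - b′) + (- (b * a′) + b * b′)     ≈⟨ +-cong (distribˡ a a′ (- b′)) (+-cong (sym (-‿distribˡ-* b a′)) -b*-b′≈b*b′) ⟨
    a * (a′ - b′) + (- b * a′ + - b * - b′)         ≈⟨ +-congˡ (distribˡ (- b) a′ (- b′)) ⟨
    a * (a′ - b′) + - b * (a′ - b′)                 ≈⟨ distribʳ (a′ - b′) a (- b) ⟨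
    (a - b) * (a′ - b′)                             ∎
    where
    -b*-b′≈b*b′ : - b * - b′ ≈ b * b′
    -b*-b′≈b*b′ = trans (sym (-‿distribˡ-* b (- b′)))
      (trans (-‿cong (sym (-‿distribʳ-* b b′))) (⁻¹-involutive (b * b′)))

  differences⟶R : differences -Raw-AlmostCommutative⟶ fromCommutativeRing R
  differences⟶R = record
    { ⟦_⟧    = λ (m , n) → m · 1# - n · 1#
    ; +-homo = λ (m , n) (m′ , n′) → trans
        (+-cong (×-homo-+ 1# m m′) (trans (-‿cong (×-homo-+ 1# n n′)) (sym (⁻¹-∙-comm _ _))))
        (interchange _ _ _ _)
    ; *-homo = λ (m , n) (m′ , n′) → trans
        (+-cong (products m m′ n n′) (-‿cong (products m n′ n m′)))
        (*-expand-differences _ _ _ _)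
    ; -‿homo = λ (m , n) → trans (+-comm _ _)
        (trans (+-congˡ (sym (⁻¹-involutive _))) (⁻¹-∙-comm _ _))
    ; 0-homo = -‿inverseʳ 0#
    ; 1-homo = trans (+-cong (+-identityʳ 1#) ε⁻¹≈ε) (+-identityʳ 1#)
    }
    where
    products : ∀ a b c d → (a ℕ.* b ℕ.+ c ℕ.* d) · 1# ≈ a · 1# * b · 1# + c · 1# * d · 1#
    products a b c d = trans (×-homo-+ 1# (a ℕ.* b) (c ℕ.* d)) (+-cong (×1-homo-* a b) (×1-homo-* c d))

  cross-sum : ∀ {a b c d} → a + d ≈ c + b → a - b ≈ c - d
  cross-sum {a} {b} {c} {d} eq = begin
    a - b                 ≈⟨ pad a b d ⟩
    (a + d) + (- b + - d) ≈⟨ +-cong eq (+-comm _ _) ⟩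
    (c + b) + (- d + - b) ≈⟨ pad c d b ⟨
    c - d                 ∎
    where
    pad : ∀ x y z → x - y ≈ (x + z) + (- y + - z)
    pad x y z = trans (sym (+-identityʳ _)) (trans (+-congˡ (sym (-‿inverseʳ z))) (interchange _ _ _ _))

  -- Only equality of the represented integers is tested. Distinct integers may coincide in `R`, so
  -- a failed test decides nothing.
  _≟ᶜ_ : ∀ (i j : ℕ × ℕ) → Maybe (proj₁ i · 1# - proj₂ i · 1# ≈ proj₁ j · 1# - proj₂ j · 1#)
  (m , n) ≟ᶜ (m′ , n′) with m ℕ.+ n′ ℕ.≟ m′ ℕ.+ n
  ... | no _   = nothing
  ... | yes eq = just (cross-sum (trans (sym (×-homo-+ 1# m n′)) (trans (×-congˡ eq) (×-homo-+ 1# m′ n))))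

  open Algebra.Solver.Ring differences (fromCommutativeRing R) differences⟶R _≟ᶜ_ public
    using (solve; _:=_; _:+_; _:*_; :-_; _:-_)

-- Polynomials over a commutative ring and their roots.

module Polynomial (R : CommutativeRing 0ℓ 0ℓ) where
  open CommutativeRing R hiding (zero)
  open IntegerCoefficientSolver R
  open Algebra.Properties.Semiring.Exp semiring using (_^_)
  open Relation.Binary.Reasoning.Setoid setoid

  -- Roots will be counted in corner rings, which may have zero divisors. Points are therefore
  -- required to have regular differences, which is more than being distinct.
  Regular : Carrier → Set
  Regular a = ∀ y → a * y ≈ 0# → y ≈ 0#

  -- a zero + a 1 * x + … + c * x ^ n
  eval : ∀ {n} → Carrier → (Fin n → Carrier) → Carrier → Carrier
  eval {zero}  c a x = c
  eval {suc n} c a x = a zero + x * eval c (a ∘ suc) x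

  eval-difference : ∀ {n} c c′ (a a′ : Fin n → Carrier) x →
    eval (c - c′) (λ i → a i - a′ i) x ≈ eval c a x - eval c′ a′ x
  eval-difference {zero}  c c′ a a′ x = refl
  eval-difference {suc n} c c′ a a′ x = trans
    (+-congˡ (*-congˡ (eval-difference c c′ (a ∘ suc) (a′ ∘ suc) x)))
    (solve 5 (λ a a′ x e e′ → (a :- a′) :+ x :* (e :- e′) := (a :+ x :* e) :- (a′ :+ x :* e′))
      refl (a zero) (a′ zero) x _ _)

  -- The coefficients of (f X - f r) / (X - r) for f with coefficients
  -- c and b ∷ a (they do not depend on the constant coefficient b).
  quotient : ∀ {n} → Carrier → (Fin n → Carrier) → Carrier → Fin n → Carrier
  quotient c a r zero    = eval c a r
  quotient c a r (suc i) = quotient c (a ∘ suc) r i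

  division : ∀ {n} c (a : Fin (suc n) → Carrier) x r →
    eval c a x - eval c a r ≈ (x - r) * eval c (quotient c (a ∘ suc) r) x
  division {zero} c a x r =
    solve 4 (λ b c x r → (b :+ x :* c) :- (b :+ r :* c) := (x :- r) :* c) refl (a zero) c x r
  division {suc n} c a x r = begin
    (b + x * f x) - (b + r * f r)
      ≈⟨ solve 5 (λ b x r fx fr → (b :+ x :* fx) :- (b :+ r :* fr) := (x :- r) :* fr :+ x :* (fx :- fr))
           refl b x r (f x) (f r) ⟩
    (x - r) * f r + x * (f x - f r)
      ≈⟨ +-congˡ (*-congˡ (division c (a ∘ suc) x r)) ⟩
    (x - r) * f r + x * ((x - r) * g)
      ≈⟨ solve 4 (λ x r fr g → (x :- r) :* fr :+ x :* ((x :- r) :* g) := (x :- r) :* (fr :+ x :* g))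
           refl x r (f r) g ⟩
    (x - r) * (f r + x * g)
      ∎
    where
    b : Carrier
    b = a zero
    f : Carrier → Carrier
    f = eval c (a ∘ suc)
    g : Carrier
    g = eval {n} c (quotient c (λ i → a (suc (suc i))) r) x

  -‿zero : ∀ {x y} → x ≈ 0# → y ≈ 0# → x - y ≈ 0#
  -‿zero x≈0 y≈0 = trans (+-cong x≈0 (-‿cong y≈0)) (-‿inverseʳ 0#)

  RegularDifferences : ∀ {n} → (Fin n → Carrier) → Set
  RegularDifferences x = ∀ {i j} → i ≢ j → Regular (x i - x j)

  -- At another root `r` of f, the division identity reads `0 = (r - x zero) * g r` for the quotient
  -- g, and the first factor is regular.
  quotient-roots : ∀ {n k} c (a : Fin (suc n) → Carrier) (x : Fin (suc k) → Carrier) →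
    RegularDifferences x → (∀ i → eval c a (x i) ≈ 0#) →
    ∀ i → eval c (quotient c (a ∘ suc) (x zero)) (x (suc i)) ≈ 0#
  quotient-roots c a x reg root i = reg {suc i} {zero} (λ ()) _
    (trans (sym (division c a (x (suc i)) (x zero))) (-‿zero (root (suc i)) (root zero)))

  tail-regular : ∀ {n} {x : Fin (suc n) → Carrier} → RegularDifferences x → RegularDifferences (x ∘ suc)
  tail-regular reg i≢j = reg (λ { ≡.refl → i≢j ≡.refl })

  -- Dividing by `X - x zero` lowers the degree, keeps the leading coefficient and uses up one root;
  -- at degree zero one root is left, where the value is `c` itself.
  leading≈0 : ∀ {n} c (a : Fin n → Carrier) (x : Fin (suc n) → Carrier) →
    RegularDifferences x → (∀ i → eval c a (x i) ≈ 0#) → c ≈ 0#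
  leading≈0 {zero}  c a x reg root = root zero
  leading≈0 {suc n} c a x reg root =
    leading≈0 c _ (x ∘ suc) (tail-regular reg) (quotient-roots c a x reg root)

  recover-constant : ∀ {n} c (a : Fin (suc n) → Carrier) r →
    eval c a r ≈ 0# → eval c (a ∘ suc) r ≈ 0# → a zero ≈ 0#
  recover-constant c a r fr≈0 f′r≈0 = begin
    a zero                                       ≈⟨ solve 2 (λ b y → b := (b :+ y) :- y) refl _ _ ⟩
    eval c a r - r * eval c (a ∘ suc) r          ≈⟨ -‿zero fr≈0 (trans (*-congˡ f′r≈0) (zeroʳ r)) ⟩
    0#                                           ∎

  -- The entries of the quotient are the values at `r` of the successive tails of the polynomial,
  -- and each coefficient is the value of one tail minus `r` times the value of the next.
  quotient≈0 : ∀ {n} c (a : Fin n → Carrier) r → c ≈ 0# → (∀ i → quotient c a r i ≈ 0#) →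
    (∀ i → a i ≈ 0#) × eval c a r ≈ 0#
  quotient≈0 {zero}  c a r c≈0 q≈0 = (λ ()) , c≈0
  quotient≈0 {suc n} c a r c≈0 q≈0 with quotient≈0 c (a ∘ suc) r c≈0 (q≈0 ∘ suc)
  ... | a≈0 , f′r≈0 = (λ { zero → recover-constant c a r (q≈0 zero) f′r≈0 ; (suc i) → a≈0 i }) , q≈0 zero

  -- Uniqueness of interpolation, to be applied to differences of polynomials with equal leading
  -- coefficients. The quotient by `X - x zero` has one coefficient and one root fewer; once it
  -- vanishes, so does the polynomial.
  coefficients≈0 : ∀ {n} c (a : Fin n → Carrier) (x : Fin n → Carrier) → c ≈ 0# →
    RegularDifferences x → (∀ i → eval c a (x i) ≈ 0#) → ∀ i → a i ≈ 0#
  coefficients≈0 {suc n} c a x c≈0 reg root = λ where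
      zero    → recover-constant c a (x zero) (root zero) (proj₂ rest)
      (suc i) → proj₁ rest i
    where
    rest : (∀ i → a (suc i) ≈ 0#) × eval c (a ∘ suc) (x zero) ≈ 0#
    rest = quotient≈0 c (a ∘ suc) (x zero) c≈0
      (coefficients≈0 c _ (x ∘ suc) c≈0 (tail-regular reg) (quotient-roots c a x reg root))

  eval-monomial : ∀ m x → eval {m} 1# (λ _ → 0#) x ≈ x ^ m
  eval-monomial zero    x = refl
  eval-monomial (suc m) x = trans (+-identityˡ _) (*-congˡ (eval-monomial m x))

  -- X^q - X for q = 2 + m, with leading coefficient 1
  frobenius-coefficients : ∀ {m} → Fin (suc (suc m)) → Carrier
  frobenius-coefficients zero          = 0#
  frobenius-coefficients (suc zero)    = - 1#
  frobenius-coefficients (suc (suc _)) = 0#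

  frobenius-root : ∀ {m} x → x ^ suc (suc m) ≈ x → eval {suc (suc m)} 1# frobenius-coefficients x ≈ 0#
  frobenius-root {m} x fixed = begin
    0# + x * (- 1# + x * eval {m} 1# (λ _ → 0#) x)
      ≈⟨ +-congˡ (*-congˡ (+-congˡ (*-congˡ (eval-monomial m x)))) ⟩
    0# + x * (- 1# + x * x ^ m)
      ≈⟨ solve 4 (λ z o x y → z :+ x :* (:- o :+ x :* y) := z :+ (x :* (x :* y) :- x :* o)) refl 0# 1# x (x ^ m) ⟩
    0# + (x ^ suc (suc m) - x * 1#)
      ≈⟨ +-identityˡ _ ⟩
    x ^ suc (suc m) - x * 1#
      ≈⟨ +-cong fixed (-‿cong (*-identityʳ x)) ⟩
    x - x
      ≈⟨ -‿inverseʳ x ⟩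
    0#
      ∎

-- Binomial coefficients and the Frobenius map.

[k+1]*[n+1]C[k+1]≡[n+1]*nCk : ∀ n k → suc k ℕ.* (suc n C suc k) ≡ suc n ℕ.* (n C k)
[k+1]*[n+1]C[k+1]≡[n+1]*nCk zero zero = ≡.refl
[k+1]*[n+1]C[k+1]≡[n+1]*nCk zero (suc k)
  rewrite k>n⇒nCk≡0 {1} {suc (suc k)} (s≤s (s≤s z≤n)) | k>n⇒nCk≡0 {0} {suc k} (s≤s z≤n) = ℕ.*-zeroʳ k
[k+1]*[n+1]C[k+1]≡[n+1]*nCk (suc n) zero = ≡.trans (ℕ.*-identityˡ _)
  (≡.trans (nC1≡n (suc (suc n))) (≡.sym (ℕ.*-identityʳ (suc (suc n)))))
[k+1]*[n+1]C[k+1]≡[n+1]*nCk (suc n) (suc k) = begin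
  suc (suc k) ℕ.* (suc (suc n) C suc (suc k))
    ≡⟨ ≡.cong (suc (suc k) ℕ.*_) (nCk+nC[k+1]≡[n+1]C[k+1] (suc n) (suc k)) ⟨
  suc (suc k) ℕ.* (a ℕ.+ (suc n C suc (suc k)))
    ≡⟨ ℕ.*-distribˡ-+ (suc (suc k)) a _ ⟩
  (a ℕ.+ suc k ℕ.* a) ℕ.+ suc (suc k) ℕ.* (suc n C suc (suc k))
    ≡⟨ ≡.cong₂ (λ x y → (a ℕ.+ x) ℕ.+ y) ([k+1]*[n+1]C[k+1]≡[n+1]*nCk n k) ([k+1]*[n+1]C[k+1]≡[n+1]*nCk n (suc k)) ⟩
  (a ℕ.+ suc n ℕ.* (n C k)) ℕ.+ suc n ℕ.* (n C suc k)
    ≡⟨ ℕ.+-assoc a _ _ ⟩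
  a ℕ.+ (suc n ℕ.* (n C k) ℕ.+ suc n ℕ.* (n C suc k))
    ≡⟨ ≡.cong (a ℕ.+_) (ℕ.*-distribˡ-+ (suc n) (n C k) (n C suc k)) ⟨
  a ℕ.+ suc n ℕ.* ((n C k) ℕ.+ (n C suc k))
    ≡⟨ ≡.cong (λ x → a ℕ.+ suc n ℕ.* x) (nCk+nC[k+1]≡[n+1]C[k+1] n k) ⟩
  suc (suc n) ℕ.* a
    ∎
  where
  open ≡.≡-Reasoning
  a : ℕ
  a = suc n C suc k

-- By the absorption identity the prime divides `suc k` times the binomial coefficient, and it is
-- too large to divide `suc k`.
prime∣nCk : ∀ {n k} → Prime (suc n) → k ℕ.< n → suc n ℕ.∣ suc n C suc k
prime∣nCk {n} {k} pr k<n
  with euclidsLemma (suc k) (suc n C suc k) pr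
         (≡.subst (suc n ℕ.∣_) (≡.sym ([k+1]*[n+1]C[k+1]≡[n+1]*nCk n k)) (m∣m*n (n C k)))
... | inj₁ p∣k+1 = contradiction (∣⇒≤ p∣k+1) (ℕ.<⇒≱ (s≤s k<n))
... | inj₂ p∣C   = p∣C

module Frobenius (R : CommutativeRing 0ℓ 0ℓ) where
  open CommutativeRing R hiding (zero)
  open Algebra.Properties.CommutativeSemiring.Binomial commutativeSemiring using (theorem; binomialTerm)
  open Algebra.Properties.Semiring.Exp semiring
  open Algebra.Properties.Monoid.Sum +-monoid
  open Algebra.Properties.Semiring.Mult semiring using (×-congˡ; ×-assocˡ; ×-homo-1) renaming (_×_ to _·_)
  open Relation.Binary.Reasoning.Setoid setoid

  HasCharacteristic : ℕ → Set
  HasCharacteristic p = ∀ x → p · x ≈ 0#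

  sum≈0 : ∀ {n} (f : Fin n → Carrier) → (∀ i → f i ≈ 0#) → sum f ≈ 0#
  sum≈0 {n} f f≈0 = trans (sum-cong-≋ f≈0) (sum-replicate-zero n)

  multiple≈0 : ∀ {p m} → HasCharacteristic p → p ℕ.∣ m → ∀ x → m · x ≈ 0#
  multiple≈0 {p} char (divides k ≡.refl) x =
    trans (×-congˡ (ℕ.*-comm k p)) (trans (sym (×-assocˡ x p k)) (char (k · x)))

  frobenius : ∀ {p} → Prime p → HasCharacteristic p → ∀ x y → (x + y) ^ p ≈ x ^ p + y ^ p
  frobenius {suc n} pr char x y = begin
    (x + y) ^ suc n
      ≈⟨ theorem (suc n) x y ⟩
    term zero + sum (term ∘ suc)
      ≈⟨ +-cong first (trans (sum-init-last (term ∘ suc)) (+-cong (sum≈0 _ middle) final)) ⟩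
    y ^ suc n + (0# + x ^ suc n)
      ≈⟨ trans (+-congˡ (+-identityˡ _)) (+-comm _ _) ⟩
    x ^ suc n + y ^ suc n
      ∎
    where
    term : Fin (suc (suc n)) → Carrier
    term = binomialTerm x y (suc n)
    first : term zero ≈ y ^ suc n
    first = trans (×-homo-1 _) (*-identityˡ _)
    middle : ∀ i → term (suc (inject₁ i)) ≈ 0#
    middle i = multiple≈0 char
      (prime∣nCk pr (≡.subst (ℕ._< n) (≡.sym (toℕ-inject₁ i)) (toℕ<n i))) _
    final : term (suc (fromℕ n)) ≈ x ^ suc n
    final rewrite toℕ-fromℕ n | nCn≡1 (suc n) | ℕ.n∸n≡0 n = trans (×-homo-1 _) (*-identityʳ _)

  frobenius-iterate : ∀ {p} → Prime p → HasCharacteristic p → ∀ e x y →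
    (x + y) ^ (p ℕ.^ e) ≈ x ^ (p ℕ.^ e) + y ^ (p ℕ.^ e)
  frobenius-iterate pr char zero x y = trans (*-identityʳ _) (sym (+-cong (*-identityʳ x) (*-identityʳ y)))
  frobenius-iterate {p} pr char (suc e) x y = begin
    (x + y) ^ (p ℕ.* p ℕ.^ e)                  ≈⟨ ^-assocʳ (x + y) p (p ℕ.^ e) ⟨
    ((x + y) ^ p) ^ (p ℕ.^ e)                  ≈⟨ ^-congˡ (p ℕ.^ e) (frobenius pr char x y) ⟩
    (x ^ p + y ^ p) ^ (p ℕ.^ e)                ≈⟨ frobenius-iterate pr char e (x ^ p) (y ^ p) ⟩
    (x ^ p) ^ (p ℕ.^ e) + (y ^ p) ^ (p ℕ.^ e)  ≈⟨ +-cong (^-assocʳ x p (p ℕ.^ e)) (^-assocʳ y p (p ℕ.^ e)) ⟩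
    x ^ (p ℕ.* p ℕ.^ e) + y ^ (p ℕ.* p ℕ.^ e)  ∎

-- The integers modulo p and Fermat's little theorem.

module Modular (p : ℕ) .{{_ : NonZero p}} where
  infix 4 _≈_
  _≈_ : ℕ → ℕ → Set
  x ≈ y = x % p ≡ y % p

  +-cong : ∀ {x x′ y y′} → x ≈ x′ → y ≈ y′ → x ℕ.+ y ≈ x′ ℕ.+ y′
  +-cong {x} {x′} {y} {y′} x≈x′ y≈y′ = ≡.trans (%-distribˡ-+ x y p)
    (≡.trans (≡.cong₂ (λ a b → (a ℕ.+ b) % p) x≈x′ y≈y′) (≡.sym (%-distribˡ-+ x′ y′ p)))

  *-cong : ∀ {x x′ y y′} → x ≈ x′ → y ≈ y′ → x ℕ.* y ≈ x′ ℕ.* y′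
  *-cong {x} {x′} {y} {y′} x≈x′ y≈y′ = ≡.trans (%-distribˡ-* x y p)
    (≡.trans (≡.cong₂ (λ a b → (a ℕ.* b) % p) x≈x′ y≈y′) (≡.sym (%-distribˡ-* x′ y′ p)))

  *p≈0 : ∀ x → x ℕ.* p ≈ 0
  *p≈0 x = ≡.trans (m*n%n≡0 x p) (≡.sym (m*n%n≡0 0 p))

  -- Residues are represented by natural numbers, and `-1` by `p - 1`.
  neg : ℕ → ℕ
  neg x = ℕ.pred p ℕ.* x

  neg-inverseˡ : ∀ x → neg x ℕ.+ x ≈ 0
  neg-inverseˡ x = ≡.trans (≡.cong (_% p) (≡.trans (ℕ.+-comm (neg x) x)
    (≡.trans (≡.cong (ℕ._* x) (ℕ.suc-pred p)) (ℕ.*-comm p x)))) (*p≈0 x)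

  %-reflexive : ∀ {x y} → x ≡ y → x ≈ y
  %-reflexive = ≡.cong (_% p)

  commutativeRing : CommutativeRing 0ℓ 0ℓ
  commutativeRing = record
    { Carrier = ℕ ; _≈_ = _≈_ ; _+_ = ℕ._+_ ; _*_ = ℕ._*_ ; -_ = neg ; 0# = 0 ; 1# = 1
    ; isCommutativeRing = record
      { isRing = record
        { +-isAbelianGroup = record
          { isGroup = record
            { isMonoid = record
              { isSemigroup = record
                { isMagma = record
                  { isEquivalence = record { refl = ≡.refl ; sym = ≡.sym ; trans = ≡.trans }
                  ; ∙-cong = λ {x} {x′} {y} {y′} → +-cong {x} {x′} {y} {y′}
                  }
                ; assoc = λ x y z → %-reflexive (ℕ.+-assoc x y z)
                }
              ; identity = (λ _ → ≡.refl) , λ x → %-reflexive (ℕ.+-identityʳ x)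
              }
            ; inverse = neg-inverseˡ , λ x → ≡.trans (%-reflexive (ℕ.+-comm x (neg x))) (neg-inverseˡ x)
            ; ⁻¹-cong = λ {x} {y} → *-cong {ℕ.pred p} {ℕ.pred p} {x} {y} ≡.refl
            }
          ; comm = λ x y → %-reflexive (ℕ.+-comm x y)
          }
        ; *-cong = λ {x} {x′} {y} {y′} → *-cong {x} {x′} {y} {y′}
        ; *-assoc = λ x y z → %-reflexive (ℕ.*-assoc x y z)
        ; *-identity = (λ x → %-reflexive (ℕ.*-identityˡ x)) , λ x → %-reflexive (ℕ.*-identityʳ x)
        ; distrib = (λ x y z → %-reflexive (ℕ.*-distribˡ-+ x y z)) , λ x y z → %-reflexive (ℕ.*-distribʳ-+ x y z)
        }
      ; *-comm = λ x y → %-reflexive (ℕ.*-comm x y)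
      }
    }

  open CommutativeRing commutativeRing using (semiring)
  open Frobenius commutativeRing
  open Algebra.Properties.Semiring.Exp semiring using (_^_; ^-assocʳ; ^-congˡ)
  open Algebra.Properties.Semiring.Mult semiring using () renaming (_×_ to _·_)

  ·≡* : ∀ n x → n · x ≡ n ℕ.* x
  ·≡* zero    x = ≡.refl
  ·≡* (suc n) x = ≡.cong (x ℕ.+_) (·≡* n x)

  characteristic : HasCharacteristic p
  characteristic x = ≡.trans (%-reflexive (≡.trans (·≡* p x) (ℕ.*-comm p x))) (*p≈0 x)

  1^ : ∀ n → 1 ^ n ≡ 1
  1^ zero    = ≡.refl
  1^ (suc n) = ≡.trans (ℕ.*-identityˡ _) (1^ n)

  -- Induction on `x`: the Frobenius map is additive on `1 + x` and fixes 1.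
  fermat : Prime p → ∀ x → x ^ p ≈ x
  fermat pr zero    = 0^ p
    where
    0^ : ∀ n .{{_ : NonZero n}} → 0 ^ n ≈ 0
    0^ (suc n) = ≡.refl
  fermat pr (suc x) = ≡.trans (frobenius pr characteristic 1 x)
    (+-cong {1 ^ p} {1} {x ^ p} {x} (%-reflexive (1^ p)) (fermat pr x))

  fermat-iterate : Prime p → ∀ e x → x ^ (p ℕ.^ e) ≈ x
  fermat-iterate pr zero    x = %-reflexive (ℕ.*-identityʳ x)
  fermat-iterate pr (suc e) x = ≡.trans (≡.sym (^-assocʳ x p (p ℕ.^ e)))
    (≡.trans (^-congˡ (p ℕ.^ e) {x ^ p} {x} (fermat pr x)) (fermat-iterate pr e x))

-- Finite products and divisibility.

module Product (R : CommutativeRing 0ℓ 0ℓ) where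
  open CommutativeRing R hiding (zero)

  infix 4 _∣_
  _∣_ : Carrier → Carrier → Set
  a ∣ b = ∃[ y ] a * y ≈ b

  product : ∀ {k} → (Fin k → Carrier) → Carrier
  product {zero}  f = 1#
  product {suc k} f = f zero * product (f ∘ suc)

  ∣-*ʳ : ∀ {a b} c → a ∣ b → a ∣ b * c
  ∣-*ʳ {a} c (y , ay≈b) = y * c , trans (sym (*-assoc a y c)) (*-congʳ ay≈b)

  ∣-*ˡ : ∀ {a b} c → a ∣ b → a ∣ c * b
  ∣-*ˡ {a} c (y , ay≈b) = y * c , trans (sym (*-assoc a y c)) (trans (*-congʳ ay≈b) (*-comm _ c))

  ∣-product : ∀ {k} (f : Fin k → Carrier) i → f i ∣ product f
  ∣-product f zero    = product (f ∘ suc) , refl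
  ∣-product f (suc i) = ∣-*ˡ (f zero) (∣-product (f ∘ suc) i)

-- Adjoining a universal solution of `x ^ (N + 1) = x`.

-- The quotient R[X]/(X^(N+1) - X).  A polynomial is a list of terms (c , n)
-- standing for c X^n.  Polynomials are equal in the quotient when they are
-- not separated by the R-linear functionals X^n ↦ w n vanishing on the ideal.
module Adjoin (R : CommutativeRing 0ℓ 0ℓ) (N : ℕ) .{{_ : NonZero N}} where
  open CommutativeRing R hiding (zero)
  open Algebra.Properties.AbelianGroup +-abelianGroup using (⁻¹-∙-comm; ε⁻¹≈ε)
  open Algebra.Properties.CommutativeSemigroup +-commutativeSemigroup using (interchange)
  open Algebra.Properties.Ring ring using (-‿distribˡ-*)
  open Relation.Binary.Reasoning.Setoid setoid

  Poly : Set
  Poly = List (Carrier × ℕ)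

  functional : (ℕ → Carrier) → Poly → Carrier
  functional w []            = 0#
  functional w ((c , n) ∷ l) = c * w n + functional w l

  -- The functional vanishes on `X^n (X^(N+1) - X)` for every n. The period starts only at index 1,
  -- since in the quotient the power `X^0` differs from `X^N`.
  record Periodic (w : ℕ → Carrier) : Set where
    field
      period : ∀ n → w (suc N ℕ.+ n) ≈ w (suc n)
  open Periodic

  infix 4 _≋_
  _≋_ : Poly → Poly → Set
  l ≋ m = ∀ w → Periodic w → functional w l ≈ functional w m

  scale : Carrier × ℕ → Poly → Poly
  scale (c , n) = map (λ (d , m) → c * d , n ℕ.+ m)

  infixl 7 _⊛_
  _⊛_ : Poly → Poly → Poly
  []      ⊛ m = []
  (t ∷ l) ⊛ m = scale t m ++ l ⊛ m

  ⊝_ : Poly → Poly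
  ⊝_ = map (λ (c , n) → - c , n)

  functional-cong : ∀ {v w} → (∀ n → v n ≈ w n) → ∀ l → functional v l ≈ functional w l
  functional-cong v≈w []            = refl
  functional-cong v≈w ((c , n) ∷ l) = +-cong (*-congˡ (v≈w n)) (functional-cong v≈w l)

  functional-++ : ∀ w l m → functional w (l ++ m) ≈ functional w l + functional w m
  functional-++ w []            m = sym (+-identityˡ _)
  functional-++ w ((c , n) ∷ l) m = trans (+-congˡ (functional-++ w l m)) (sym (+-assoc _ _ _))

  functional-⊝ : ∀ w l → functional w (⊝ l) ≈ - functional w l
  functional-⊝ w []            = sym ε⁻¹≈ε
  functional-⊝ w ((c , n) ∷ l) = trans
    (+-cong (sym (-‿distribˡ-* c (w n))) (functional-⊝ w l)) (⁻¹-∙-comm _ _)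

  functional-0 : ∀ l → functional (λ _ → 0#) l ≈ 0#
  functional-0 []            = refl
  functional-0 ((c , n) ∷ l) = trans (+-cong (zeroʳ c) (functional-0 l)) (+-identityˡ 0#)

  functional-+ : ∀ v w l → functional (λ n → v n + w n) l ≈ functional v l + functional w l
  functional-+ v w []            = sym (+-identityˡ 0#)
  functional-+ v w ((c , n) ∷ l) = trans
    (+-cong (distribˡ c (v n) (w n)) (functional-+ v w l)) (interchange _ _ _ _)

  functional-* : ∀ a w l → functional (λ n → a * w n) l ≈ a * functional w l
  functional-* a w []            = sym (zeroʳ a)
  functional-* a w ((c , n) ∷ l) = begin
    c * (a * w n) + functional (λ n → a * w n) l ≈⟨ +-cong swap (functional-* a w l) ⟩
    a * (c * w n) + a * functional w l           ≈⟨ distribˡ a _ _ ⟨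
    a * (c * w n + functional w l)               ∎
    where
    swap : c * (a * w n) ≈ a * (c * w n)
    swap = trans (sym (*-assoc c a _)) (trans (*-congʳ (*-comm c a)) (*-assoc a c _))

  functional-scale : ∀ w c n l → functional w (scale (c , n) l) ≈ c * functional (w ∘ (n ℕ.+_)) l
  functional-scale w c n []            = sym (zeroʳ c)
  functional-scale w c n ((d , m) ∷ l) = trans
    (+-cong (*-assoc c d _) (functional-scale w c n l)) (sym (distribˡ c _ _))

  -- A product becomes an iterated functional, which reduces the ring laws of `⊛` to linearity and
  -- to exchanging the two functionals.
  functional-⊛ : ∀ w l m → functional w (l ⊛ m) ≈ functional (λ n → functional (w ∘ (n ℕ.+_)) m) l
  functional-⊛ w []            m = refl
  functional-⊛ w ((c , n) ∷ l) m = trans (functional-++ w (scale (c , n) m) (l ⊛ m))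
    (+-cong (functional-scale w c n m) (functional-⊛ w l m))

  fubini : ∀ (w : ℕ → ℕ → Carrier) l m →
    functional (λ n → functional (w n) m) l ≈ functional (λ k → functional (λ n → w n k) l) m
  fubini w []            m = sym (functional-0 m)
  fubini w ((c , n) ∷ l) m = trans
    (+-cong (sym (functional-* c (w n) m)) (fubini w l m))
    (sym (functional-+ (λ k → c * w n k) (λ k → functional (λ n → w n k) l) m))

  periodic-shift : ∀ {w} k → Periodic w → Periodic (w ∘ (k ℕ.+_))
  periodic-shift {w} k per .period n = begin
    w (k ℕ.+ (suc N ℕ.+ n)) ≡⟨ ≡.cong w (≡.trans (≡.sym (ℕ.+-assoc k (suc N) n))
                                 (≡.trans (≡.cong (ℕ._+ n) (ℕ.+-comm k (suc N))) (ℕ.+-assoc (suc N) k n))) ⟩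
    w (suc N ℕ.+ (k ℕ.+ n)) ≈⟨ per .period (k ℕ.+ n) ⟩
    w (suc (k ℕ.+ n))       ≡⟨ ≡.cong w (ℕ.+-suc k n) ⟨
    w (k ℕ.+ suc n)         ∎

  -- Multiplying by `m` and then applying `w` is again a functional that vanishes on the ideal. This
  -- is what makes `≋` compatible with `⊛`.
  periodic-functional : ∀ {w} m → Periodic w → Periodic (λ n → functional (w ∘ (n ℕ.+_)) m)
  periodic-functional {w} m per .period n = functional-cong
    (λ k → trans (reflexive (≡.cong w (ℕ.+-assoc (suc N) n k))) (per .period (n ℕ.+ k))) m

  ⊛-cong : ∀ {l l′ m m′} → l ≋ l′ → m ≋ m′ → l ⊛ m ≋ l′ ⊛ m′
  ⊛-cong {l} {l′} {m} {m′} l≋l′ m≋m′ w per = begin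
    functional w (l ⊛ m)                                ≈⟨ functional-⊛ w l m ⟩
    functional (λ n → functional (w ∘ (n ℕ.+_)) m) l    ≈⟨ l≋l′ _ (periodic-functional m per) ⟩
    functional (λ n → functional (w ∘ (n ℕ.+_)) m) l′   ≈⟨ functional-cong (λ n → m≋m′ _ (periodic-shift n per)) l′ ⟩
    functional (λ n → functional (w ∘ (n ℕ.+_)) m′) l′  ≈⟨ functional-⊛ w l′ m′ ⟨
    functional w (l′ ⊛ m′)                              ∎

  ⊛-comm : ∀ l m → l ⊛ m ≋ m ⊛ l
  ⊛-comm l m w per = begin
    functional w (l ⊛ m)                                ≈⟨ functional-⊛ w l m ⟩
    functional (λ n → functional (λ k → w (n ℕ.+ k)) m) l ≈⟨ fubini (λ n k → w (n ℕ.+ k)) l m ⟩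
    functional (λ k → functional (λ n → w (n ℕ.+ k)) l) m
      ≈⟨ functional-cong (λ k → functional-cong (λ n → reflexive (≡.cong w (ℕ.+-comm n k))) l) m ⟩
    functional (λ k → functional (λ n → w (k ℕ.+ n)) l) m ≈⟨ functional-⊛ w m l ⟨
    functional w (m ⊛ l)                                ∎

  ⊛-assoc : ∀ k l m → (k ⊛ l) ⊛ m ≋ k ⊛ (l ⊛ m)
  ⊛-assoc k l m w per = begin
    functional w ((k ⊛ l) ⊛ m)
      ≈⟨ trans (functional-⊛ w (k ⊛ l) m) (functional-⊛ _ k l) ⟩
    functional (λ a → functional (λ b → functional (λ c → w ((a ℕ.+ b) ℕ.+ c)) m) l) k
      ≈⟨ functional-cong (λ a → functional-cong (λ b → functional-cong (λ c →
           reflexive (≡.cong w (ℕ.+-assoc a b c))) m) l) k ⟩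
    functional (λ a → functional (λ b → functional (λ c → w (a ℕ.+ (b ℕ.+ c))) m) l) k
      ≈⟨ trans (functional-⊛ w k (l ⊛ m)) (functional-cong (λ a → functional-⊛ (w ∘ (a ℕ.+_)) l m) k) ⟨
    functional w (k ⊛ (l ⊛ m))
      ∎

  one : Poly
  one = [ 1# , 0 ]

  ⊛-identityˡ : ∀ l → one ⊛ l ≋ l
  ⊛-identityˡ l w per = trans (functional-⊛ w one l) (trans (+-identityʳ _) (*-identityˡ _))

  ⊛-distribʳ : ∀ l m k → (m ++ k) ⊛ l ≋ m ⊛ l ++ k ⊛ l
  ⊛-distribʳ l m k w per = begin
    functional w ((m ++ k) ⊛ l)                   ≈⟨ trans (functional-⊛ w (m ++ k) l) (functional-++ _ m k) ⟩
    _                                             ≈⟨ +-cong (functional-⊛ w m l) (functional-⊛ w k l) ⟨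
    functional w (m ⊛ l) + functional w (k ⊛ l)   ≈⟨ functional-++ w (m ⊛ l) (k ⊛ l) ⟨
    functional w (m ⊛ l ++ k ⊛ l)                 ∎

  ++-comm : ∀ l m → l ++ m ≋ m ++ l
  ++-comm l m w per = trans (functional-++ w l m) (trans (+-comm _ _) (sym (functional-++ w m l)))

  ⊝-inverseˡ : ∀ l → ⊝ l ++ l ≋ []
  ⊝-inverseˡ l w per = trans (functional-++ w (⊝ l) l) (trans (+-congʳ (functional-⊝ w l)) (-‿inverseˡ _))

  ≋-trans : ∀ {k l m} → k ≋ l → l ≋ m → k ≋ m
  ≋-trans k≋l l≋m w per = trans (k≋l w per) (l≋m w per)

  commutativeRing : CommutativeRing 0ℓ 0ℓ
  commutativeRing = record
    { Carrier = Poly ; _≈_ = _≋_ ; _+_ = _++_ ; _*_ = _⊛_ ; -_ = ⊝_ ; 0# = [] ; 1# = one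
    ; isCommutativeRing = record
      { isRing = record
        { +-isAbelianGroup = record
          { isGroup = record
            { isMonoid = record
              { isSemigroup = record
                { isMagma = record
                  { isEquivalence = record
                    { refl = λ _ _ → refl
                    ; sym = λ l≋m w per → sym (l≋m w per)
                    ; trans = λ {k} {l} {m} → ≋-trans {k} {l} {m}
                    }
                  ; ∙-cong = λ {l} {l′} {m} {m′} l≋l′ m≋m′ w per → trans (functional-++ w l m)
                      (trans (+-cong (l≋l′ w per) (m≋m′ w per)) (sym (functional-++ w l′ m′)))
                  }
                ; assoc = λ k l m w per → trans (trans (functional-++ w (k ++ l) m) (+-congʳ (functional-++ w k l)))
                    (trans (+-assoc _ _ _) (sym (trans (functional-++ w k (l ++ m)) (+-congˡ (functional-++ w l m)))))
                }
              ; identity = (λ _ _ _ → refl) , λ l w per → trans (functional-++ w l []) (+-identityʳ _)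
              }
            ; inverse = ⊝-inverseˡ
                , λ l → ≋-trans {l ++ ⊝ l} {⊝ l ++ l} {[]} (++-comm l (⊝ l)) (⊝-inverseˡ l)
            ; ⁻¹-cong = λ {l} {m} l≋m w per → trans (functional-⊝ w l)
                (trans (-‿cong (l≋m w per)) (sym (functional-⊝ w m)))
            }
          ; comm = ++-comm
          }
        ; *-cong = λ {l} {l′} {m} {m′} → ⊛-cong {l} {l′} {m} {m′}
        ; *-assoc = ⊛-assoc
        ; *-identity = ⊛-identityˡ
            , λ l → ≋-trans {l ⊛ one} {one ⊛ l} {l} (⊛-comm l one) (⊛-identityˡ l)
        ; distrib = (λ l m k → ≋-trans {l ⊛ (m ++ k)} {(m ++ k) ⊛ l} {l ⊛ m ++ l ⊛ k} (⊛-comm l (m ++ k))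
              (≋-trans {(m ++ k) ⊛ l} {m ⊛ l ++ k ⊛ l} {l ⊛ m ++ l ⊛ k} (⊛-distribʳ l m k)
              λ w per → trans (functional-++ w (m ⊛ l) (k ⊛ l))
                (trans (+-cong (⊛-comm m l w per) (⊛-comm k l w per)) (sym (functional-++ w (l ⊛ m) (l ⊛ k))))))
            , ⊛-distribʳ
        }
      ; *-comm = ⊛-comm
      }
    }

  periodic-multiple : ∀ {w} → Periodic w → ∀ n k → w (suc n ℕ.+ k ℕ.* N) ≈ w (suc n)
  periodic-multiple {w} per n zero    = reflexive (≡.cong w (ℕ.+-identityʳ (suc n)))
  periodic-multiple {w} per n (suc k) = begin
    w (suc n ℕ.+ (N ℕ.+ k ℕ.* N))  ≡⟨ ≡.cong (w ∘ suc) (≡.trans (≡.sym (ℕ.+-assoc n N _))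
                                        (≡.trans (≡.cong (ℕ._+ k ℕ.* N) (ℕ.+-comm n N)) (ℕ.+-assoc N n _))) ⟩
    w (suc N ℕ.+ (n ℕ.+ k ℕ.* N))  ≈⟨ per .period (n ℕ.+ k ℕ.* N) ⟩
    w (suc n ℕ.+ k ℕ.* N)          ≈⟨ periodic-multiple per n k ⟩
    w (suc n)                      ∎

  -- The exponent of the normal form of `X^n`: zero stays apart, and positive exponents are brought
  -- into the range from 1 to `N`.
  reduce : ℕ → ℕ
  reduce zero    = zero
  reduce (suc n) = suc (n % N)

  reduce< : ∀ n → reduce n ℕ.< suc N
  reduce< zero    = s≤s z≤n
  reduce< (suc n) = s≤s (m%n<n n N)

  reduce-small : ∀ {n} → n ℕ.< suc N → reduce n ≡ n
  reduce-small {zero}  _         = ≡.refl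
  reduce-small {suc n} (s≤s n<N) = ≡.cong suc (m<n⇒m%n≡m n<N)

  periodic-reduce : ∀ {w} → Periodic w → ∀ n → w n ≈ w (reduce n)
  periodic-reduce {w} per zero    = refl
  periodic-reduce {w} per (suc n) = trans (reflexive (≡.cong (w ∘ suc) (m≡m%n+[m/n]*n n N)))
    (periodic-multiple per (n % N) (n / N))

  -- For `i` at most `N` these form the basis dual to the powers `X^0`, ..., `X^N`: the functional
  -- reads off the coefficient of `X^i` in normal form.
  coefficient : ℕ → ℕ → Carrier
  coefficient i n = if does (i ℕ.≟ reduce n) then 1# else 0#

  coefficient-≡ : ∀ {i n} → i ≡ reduce n → coefficient i n ≈ 1#
  coefficient-≡ {i} {n} eq = reflexive (≡.cong (if_then 1# else 0#) (dec-true (i ℕ.≟ reduce n) eq))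

  coefficient-≢ : ∀ {i n} → i ≢ reduce n → coefficient i n ≈ 0#
  coefficient-≢ {i} {n} ¬eq = reflexive (≡.cong (if_then 1# else 0#) (dec-false (i ℕ.≟ reduce n) ¬eq))

  coefficient-periodic : ∀ i → Periodic (coefficient i)
  coefficient-periodic i .period n = reflexive (≡.cong (λ k → if does (i ℕ.≟ suc k) then 1# else 0#)
    (≡.trans (≡.cong (_% N) (ℕ.+-comm N n)) ([m+n]%n≡m%n n N)))

  open Algebra.Properties.CommutativeMonoid.Sum +-commutativeMonoid using (sum; ∑-distrib-+; sum-cong-≋; sum-replicate-zero)
  open Algebra.Properties.Semiring.Sum semiring using (*-distribˡ-sum)

  sum-single : ∀ {n} (f : Fin n → Carrier) i → (∀ j → j ≢ i → f j ≈ 0#) → sum f ≈ f i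
  sum-single {suc n} f zero    f≈0 = trans
    (+-congˡ (trans (sum-cong-≋ (λ j → f≈0 (suc j) (λ ()))) (sum-replicate-zero n))) (+-identityʳ _)
  sum-single {suc n} f (suc i) f≈0 = trans
    (+-cong (f≈0 zero (λ ())) (sum-single (f ∘ suc) i (λ j j≢i → f≈0 (suc j) (λ { ≡.refl → j≢i ≡.refl }))))
    (+-identityˡ _)

  periodic-expansion : ∀ {w} → Periodic w → ∀ n → w n ≈ sum {suc N} (λ i → w (toℕ i) * coefficient (toℕ i) n)
  periodic-expansion {w} per n = sym (begin
    sum {suc N} f ≈⟨ sum-single f i₀ (λ j j≢i₀ → trans
        (*-congˡ (coefficient-≢ (λ eq → j≢i₀ (toℕ-injective (≡.trans eq (≡.sym i₀≡)))))) (zeroʳ _)) ⟩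
    w (toℕ i₀) * coefficient (toℕ i₀) n ≈⟨ trans (*-congˡ (coefficient-≡ i₀≡)) (*-identityʳ _) ⟩
    w (toℕ i₀)                          ≡⟨ ≡.cong w i₀≡ ⟩
    w (reduce n)                        ≈⟨ periodic-reduce per n ⟨
    w n                                 ∎)
    where
    f : Fin (suc N) → Carrier
    f i = w (toℕ i) * coefficient (toℕ i) n
    i₀ : Fin (suc N)
    i₀ = fromℕ< (reduce< n)
    i₀≡ : toℕ i₀ ≡ reduce n
    i₀≡ = toℕ-fromℕ< (reduce< n)

  functional-expansion : ∀ {w} → Periodic w → ∀ l →
    functional w l ≈ sum {suc N} (λ i → w (toℕ i) * functional (coefficient (toℕ i)) l)
  functional-expansion {w} per [] = sym (trans (sum-cong-≋ {suc N} (λ i → zeroʳ (w (toℕ i)))) (sum-replicate-zero (suc N)))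
  functional-expansion {w} per ((c , n) ∷ l) = begin
    c * w n + functional w l
      ≈⟨ +-cong (trans (*-congˡ (periodic-expansion per n)) (*-distribˡ-sum c u)) (functional-expansion per l) ⟩
    sum (λ i → c * u i) + sum v
      ≈⟨ ∑-distrib-+ (λ i → c * u i) v ⟨
    sum (λ i → c * u i + v i)
      ≈⟨ sum-cong-≋ {suc N} (λ i → solve 4 (λ c w d e → c :* (w :* d) :+ w :* e := w :* (c :* d :+ e))
           refl c (w (toℕ i)) (coefficient (toℕ i) n) (functional (coefficient (toℕ i)) l)) ⟩
    sum {suc N} (λ i → w (toℕ i) * functional (coefficient (toℕ i)) ((c , n) ∷ l))
      ∎
    where
    open IntegerCoefficientSolver R
    u v : Fin (suc N) → Carrier
    u i = w (toℕ i) * coefficient (toℕ i) n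
    v i = w (toℕ i) * functional (coefficient (toℕ i)) l

  -- The quantifier over all periodic functionals becomes finite, because they are all combinations
  -- of the `N + 1` coefficient functionals.
  ≋-dec : Decidable _≈_ → Decidable _≋_
  ≋-dec _≟_ l m = map′ to from
    (all? {suc N} (λ i → functional (coefficient (toℕ i)) l ≟ functional (coefficient (toℕ i)) m))
    where
    to : (∀ (i : Fin (suc N)) → functional (coefficient (toℕ i)) l ≈ functional (coefficient (toℕ i)) m) → l ≋ m
    to eq w per = trans (functional-expansion per l)
      (trans (sum-cong-≋ {suc N} (λ i → *-congˡ {w (toℕ i)} (eq i))) (sym (functional-expansion per m)))
    from : l ≋ m → ∀ (i : Fin (suc N)) → functional (coefficient (toℕ i)) l ≈ functional (coefficient (toℕ i)) m
    from eq i = eq _ (coefficient-periodic (toℕ i))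

  ι : Carrier → Poly
  ι c = [ c , 0 ]

  X : Poly
  X = [ 1# , 1 ]

  ι-cong : ∀ {a b} → a ≈ b → ι a ≋ ι b
  ι-cong a≈b w per = +-congʳ (*-congʳ a≈b)

  ι-difference : ∀ a b → ι (a - b) ≋ ι a ++ ⊝ ι b
  ι-difference a b w per = trans (+-congʳ (distribʳ _ a (- b))) (+-assoc _ _ _)

  module Q = CommutativeRing commutativeRing

  open Product commutativeRing using (product)

  -- The product is monic of degree `k`, so a functional that kills all lower powers sees only
  -- `X^k`.
  functional-product : ∀ {k} (r : Fin k → Carrier) w → (∀ j → j ℕ.< k → w j ≈ 0#) →
    functional w (product (λ i → X ++ ⊝ ι (r i))) ≈ w k
  functional-product {zero}  r w w≈0 = trans (+-identityʳ _) (*-identityˡ _)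
  functional-product {suc k} r w w≈0 = begin
    functional w ((X ++ ⊝ ι (r zero)) ⊛ P)
      ≈⟨ functional-⊛ w (X ++ ⊝ ι (r zero)) P ⟩
    1# * functional (w ∘ suc) P + (- r zero * functional w P + 0#)
      ≈⟨ +-cong (trans (*-identityˡ _) (functional-product (r ∘ suc) (w ∘ suc) (λ j j<k → w≈0 (suc j) (s≤s j<k))))
           (trans (+-identityʳ _) (trans (*-congˡ (trans (functional-product (r ∘ suc) w (λ j j<k → w≈0 j (ℕ.m≤n⇒m≤1+n j<k)))
             (w≈0 k ℕ.≤-refl))) (zeroʳ _))) ⟩
    w (suc k) + 0#
      ≈⟨ +-identityʳ _ ⟩
    w (suc k)
      ∎
    where
    P : Poly
    P = product (λ i → X ++ ⊝ ι (r (suc i)))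

  -- As `k` is at most `N`, the power `X^k` is its own normal form, and its coefficient in the left
  -- side is `d`. Monicity of the product makes this work over a base ring with zero divisors.
  ι*product≉0 : ∀ {k} d (r : Fin k → Carrier) → k ℕ.< suc N → ¬ d ≈ 0# →
    ¬ ι d ⊛ product (λ i → X ++ ⊝ ι (r i)) ≋ []
  ι*product≉0 {k} d r k<q d≉0 eq = d≉0 (begin
    d                                                  ≈⟨ trans (+-identityʳ _) (*-identityʳ d) ⟨
    d * 1# + 0#                                        ≈⟨ +-congʳ (*-congˡ top) ⟨
    d * functional (coefficient k) P + 0#              ≈⟨ functional-⊛ (coefficient k) (ι d) P ⟨
    functional (coefficient k) (ι d ⊛ P)               ≈⟨ eq _ (coefficient-periodic k) ⟩
    0#                                                 ∎)
    where
    P : Poly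
    P = product (λ i → X ++ ⊝ ι (r i))
    top : functional (coefficient k) P ≈ 1#
    top = trans
      (functional-product r (coefficient k) (λ j j<k → coefficient-≢ {k} {j}
        (λ k≡ → ℕ.<⇒≢ j<k (≡.sym (≡.trans k≡ (reduce-small (ℕ.<-trans j<k k<q)))))))
      (coefficient-≡ {k} {k} (≡.sym (reduce-small k<q)))

  open Algebra.Properties.Semiring.Mult semiring using () renaming (_×_ to _·_)
  open Algebra.Properties.Semiring.Mult Q.semiring using () renaming (_×_ to _·Q_)
  open Algebra.Properties.Semiring.Exp semiring using (_^_)
  open Algebra.Properties.Semiring.Exp Q.semiring using () renaming (_^_ to _^Q_)

  functional-· : ∀ w n l → functional w (n ·Q l) ≈ n · functional w l
  functional-· w zero    l = refl
  functional-· w (suc n) l = trans (functional-++ w l (n ·Q l)) (+-congˡ (functional-· w n l))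

  characteristic : ∀ {p} → Frobenius.HasCharacteristic R p → Frobenius.HasCharacteristic commutativeRing p
  characteristic {p} char l w per = trans (functional-· w p l) (char (functional w l))

  term-^ : ∀ c n m → [ c , n ] ^Q m ≡ [ c ^ m , m ℕ.* n ]
  term-^ c n zero    = ≡.refl
  term-^ c n (suc m) = ≡.cong ([ c , n ] ⊛_) (term-^ c n m)

  -- Raising to the power `q = N + 1 = p ^ e` is additive, so single terms suffice: their
  -- coefficients are fixed by assumption, and `X^(q n)` equals `X^n` in the quotient.
  ^q-fixed : ∀ {p} e → Prime p → Frobenius.HasCharacteristic R p → p ℕ.^ e ≡ suc N →
    (∀ x → x ^ suc N ≈ x) → ∀ l → l ^Q suc N ≋ l
  ^q-fixed e pr char q≡ fixed [] w per = refl
  ^q-fixed {p} e pr char q≡ fixed ((c , n) ∷ l) w per = begin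
    functional w (((c , n) ∷ l) ^Q suc N)
      ≈⟨ additive w per ⟩
    functional w ([ c , n ] ^Q suc N ++ l ^Q suc N)
      ≈⟨ functional-++ w ([ c , n ] ^Q suc N) (l ^Q suc N) ⟩
    functional w ([ c , n ] ^Q suc N) + functional w (l ^Q suc N)
      ≈⟨ +-cong (trans (reflexive (≡.cong (functional w) (term-^ c n (suc N)))) (+-identityʳ _))
           (^q-fixed e pr char q≡ fixed l w per) ⟩
    c ^ suc N * w (suc N ℕ.* n) + functional w l
      ≈⟨ +-congʳ (*-cong (fixed c) (w-fixed n)) ⟩
    c * w n + functional w l
      ∎
    where
    additive : ((c , n) ∷ l) ^Q suc N ≋ [ c , n ] ^Q suc N ++ l ^Q suc N
    additive = ≡.subst (λ q → ((c , n) ∷ l) ^Q q ≋ [ c , n ] ^Q q ++ l ^Q q) q≡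
      (Frobenius.frobenius-iterate commutativeRing pr (characteristic {p} char) e [ c , n ] l)
    w-fixed : ∀ n → w (suc N ℕ.* n) ≈ w n
    w-fixed zero    = reflexive (≡.cong w (ℕ.*-zeroʳ (suc N)))
    -- The exponent `(N + 1)(n + 1)` exceeds `n + 1` by `n + 1` full periods.
    w-fixed (suc n) = trans (reflexive (≡.cong (λ k → w (suc n ℕ.+ k)) (ℕ.*-comm N (suc n)))) (periodic-multiple per n (suc n))

-- Towers of adjoined roots.

∣-swap : ∀ (R : CommutativeRing 0ℓ 0ℓ) → let open CommutativeRing R; open Product R in
  ∀ {a b c} → (a - b) ∣ c → (b - a) ∣ c
∣-swap R {a} {b} (y , eq) = - y ,
  trans (solve 3 (λ a b y → (b :- a) :* (:- y) := (a :- b) :* y) refl a b y) eq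
  where
  open CommutativeRing R
  open IntegerCoefficientSolver R

-- d plays the role of the Vandermonde determinant of the roots.
record RootExtension (p q k : ℕ) : Set₁ where
  field
    ring : CommutativeRing 0ℓ 0ℓ
  open CommutativeRing ring hiding (ring) public
  open Product ring public
  open Algebra.Properties.Semiring.Exp semiring public using (_^_)
  field
    _≟_   : Decidable _≈_
    char  : Frobenius.HasCharacteristic ring p
    fixed : ∀ x → x ^ q ≈ x
    root  : Fin k → Carrier
    d     : Carrier
    d≉0   : ¬ d ≈ 0#
    root-difference∣d : ∀ {i j} → i ≢ j → (root i - root j) ∣ d

module _ {p : ℕ} (e : ℕ) (pr : Prime p) where

  prime-field : ∀ {q} → p ℕ.^ e ≡ q → RootExtension p q 0
  prime-field ≡.refl = record
    { ring  = commutativeRing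
    ; _≟_   = λ x y → x % p ℕ.≟ y % p
    ; char  = characteristic
    ; fixed = fermat-iterate pr e
    ; root  = λ ()
    -- The Vandermonde determinant of the empty family.
    ; d     = 1
    ; d≉0   = λ 1≈0 → ℕ.1+n≢0 (≡.trans (≡.sym (m<n⇒m%n≡m 1<p)) (≡.trans 1≈0 (m<n⇒m%n≡m (ℕ.<-trans (s≤s z≤n) 1<p))))
    ; root-difference∣d = λ { {()} }
    }
    where
    instance
      _ = prime⇒nonZero pr
    open Modular p
    1<p : 1 ℕ.< p
    1<p = ℕ.nonTrivial⇒n>1 p {{prime⇒nonTrivial pr}}

  adjoin-root : ∀ {N k} .{{_ : NonZero N}} → p ℕ.^ e ≡ suc N → k ℕ.< suc N →
    RootExtension p (suc N) k → RootExtension p (suc N) (suc k)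
  adjoin-root {N} {k} q≡ k<q K = record
    { ring  = A.commutativeRing
    ; _≟_   = A.≋-dec K._≟_
    ; char  = A.characteristic {p} K.char
    ; fixed = A.^q-fixed e pr K.char q≡ K.fixed
    ; root  = root
    ; d     = d
    ; d≉0   = A.ι*product≉0 K.d K.root k<q K.d≉0
    ; root-difference∣d = divides-d
    }
    where
    module K = RootExtension K
    module A = Adjoin K.ring N
    module L = CommutativeRing A.commutativeRing
    open Product A.commutativeRing
    root : Fin (suc k) → A.Poly
    root zero    = A.X
    root (suc i) = A.ι (K.root i)
    linear : Fin k → A.Poly
    linear i = A.X ++ A.⊝ A.ι (K.root i)
    -- The recursion for Vandermonde determinants: the old one times all differences between the new
    -- root `X` and the old roots.
    d : A.Poly
    d = A.ι K.d A.⊛ product linear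
    ι-∣ : ∀ {a b c} → (a K.- b) K.∣ c → (A.ι a ++ A.⊝ A.ι b) ∣ A.ι c
    ι-∣ {a} {b} {c} (y , eq) = A.ι y , L.trans
      {(A.ι a ++ A.⊝ A.ι b) A.⊛ A.ι y} {A.ι (a K.- b) A.⊛ A.ι y} {A.ι c}
      (L.*-congʳ {A.ι y} {A.ι a ++ A.⊝ A.ι b} {A.ι (a K.- b)} (L.sym {A.ι (a K.- b)} {A.ι a ++ A.⊝ A.ι b} (A.ι-difference a b)))
      (A.ι-cong eq)
    X-difference∣d : ∀ j → (A.X ++ A.⊝ A.ι (K.root j)) ∣ d
    X-difference∣d j = ∣-*ˡ {linear j} {product linear} (A.ι K.d) (∣-product linear j)
    divides-d : ∀ {i j} → i ≢ j → (root i ++ A.⊝ root j) ∣ d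
    divides-d {zero}  {zero}  i≢j = contradiction ≡.refl i≢j
    divides-d {zero}  {suc j} i≢j = X-difference∣d j
    divides-d {suc i} {zero}  i≢j = ∣-swap A.commutativeRing {A.X} {A.ι (K.root i)} {d} (X-difference∣d i)
    divides-d {suc i} {suc j} i≢j =
      ∣-*ʳ {A.ι (K.root i) ++ A.⊝ A.ι (K.root j)} {A.ι K.d} (product linear)
        (ι-∣ (K.root-difference∣d (i≢j ∘ ≡.cong suc)))

  adjoin-roots : ∀ {N} .{{_ : NonZero N}} → p ℕ.^ e ≡ suc N → ∀ k → k ℕ.≤ suc N → RootExtension p (suc N) k
  adjoin-roots q≡ zero    k≤q = prime-field q≡
  adjoin-roots q≡ (suc k) k<q = adjoin-root q≡ k<q (adjoin-roots q≡ k (ℕ.<⇒≤ k<q))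

-- Idempotents and corner rings.

module Idempotent (R : CommutativeRing 0ℓ 0ℓ) where
  open CommutativeRing R hiding (zero)
  open Algebra.Properties.Semiring.Exp semiring using (_^_)
  open IntegerCoefficientSolver R
  open Relation.Binary.Reasoning.Setoid setoid
  open Polynomial using (Regular)

  infix 4 _≤_
  _≤_ : Carrier → Carrier → Set
  e ≤ f = e * f ≈ e

  -- In the second case, for positive `N`, the element `a` is invertible in the corner of `e`: its
  -- power `a ^ N` acts there as 1.
  Separates : ℕ → Carrier → Carrier → Set
  Separates N e a = e * a ≈ 0# ⊎ e * a ^ N ≈ e

  ≤-separates : ∀ {N e f a} → e ≤ f → Separates N f a → Separates N e a
  ≤-separates {N} {e} {f} {a} ef≈e (inj₁ fa≈0) = inj₁ (begin
    e * a        ≈⟨ *-congʳ ef≈e ⟨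
    (e * f) * a  ≈⟨ *-assoc e f a ⟩
    e * (f * a)  ≈⟨ trans (*-congˡ fa≈0) (zeroʳ e) ⟩
    0#           ∎)
  ≤-separates {N} {e} {f} {a} ef≈e (inj₂ fa≈f) = inj₂ (begin
    e * a ^ N        ≈⟨ *-congʳ ef≈e ⟨
    (e * f) * a ^ N  ≈⟨ *-assoc e f _ ⟩
    e * (f * a ^ N)  ≈⟨ *-congˡ fa≈f ⟩
    e * f            ≈⟨ ef≈e ⟩
    e                ∎)

  ≤-trans : ∀ {e f g} → e ≤ f → f ≤ g → e ≤ g
  ≤-trans {e} {f} {g} e≤f f≤g = begin
    e * g        ≈⟨ *-congʳ e≤f ⟨
    (e * f) * g  ≈⟨ *-assoc e f g ⟩
    e * (f * g)  ≈⟨ *-congˡ f≤g ⟩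
    e * f        ≈⟨ e≤f ⟩
    e            ∎

  module _ (_≟_ : Decidable _≈_) (m : ℕ) (fixed : ∀ x → x ^ suc (suc m) ≈ x) where

    N : ℕ
    N = suc m

    ^N-idempotent : ∀ a → a ^ N * a ^ N ≈ a ^ N
    ^N-idempotent a = begin
      (a * a ^ m) * a ^ N   ≈⟨ *-congʳ (*-comm a (a ^ m)) ⟩
      (a ^ m * a) * a ^ N   ≈⟨ *-assoc (a ^ m) a (a ^ N) ⟩
      a ^ m * (a * a ^ N)   ≈⟨ *-congˡ (fixed a) ⟩
      a ^ m * a             ≈⟨ *-comm (a ^ m) a ⟩
      a ^ N                 ∎

    -- If a is neither zero nor invertible on the idempotent f, pass to
    -- the part f - f a^N of f on which a vanishes.
    module _ (a f : Carrier) (ff≈f : f * f ≈ f) where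

      b g : Carrier
      b = a ^ N
      g = f - f * b

      g≈0⇒fb≈f : g ≈ 0# → f * b ≈ f
      g≈0⇒fb≈f g≈0 = begin
        f * b      ≈⟨ +-identityˡ _ ⟨
        0# + f * b ≈⟨ +-congʳ g≈0 ⟨
        g + f * b  ≈⟨ solve 2 (λ f x → (f :- x) :+ x := f) refl f (f * b) ⟩
        f          ∎

      gg≈g : g * g ≈ g
      gg≈g = begin
        g * g
          ≈⟨ solve 2 (λ f b → (f :- f :* b) :* (f :- f :* b) := f :* f :- f :* f :* b :- f :* f :* (b :- b :* b)) refl f b ⟩
        f * f - f * f * b - f * f * (b - b * b)
          ≈⟨ +-cong (+-cong ff≈f (-‿cong (*-congʳ ff≈f))) (-‿cong (*-congˡ (+-congˡ (-‿cong (^N-idempotent a))))) ⟩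
        f - f * b - f * f * (b - b)
          ≈⟨ solve 2 (λ f b → f :- f :* b :- f :* f :* (b :- b) := f :- f :* b) refl f b ⟩
        g
          ∎

      g≤f : g ≤ f
      g≤f = trans (solve 2 (λ f b → (f :- f :* b) :* f := f :* f :- f :* f :* b) refl f b)
        (+-cong ff≈f (-‿cong (*-congʳ ff≈f)))

      ga≈0 : g * a ≈ 0#
      ga≈0 = begin
        g * a                    ≈⟨ solve 3 (λ f b a → (f :- f :* b) :* a := f :* (a :- a :* b)) refl f b a ⟩
        f * (a - a * b)          ≈⟨ *-congˡ (+-congˡ (-‿cong (fixed a))) ⟩
        f * (a - a)              ≈⟨ *-congˡ (-‿inverseʳ a) ⟩
        f * 0#                   ≈⟨ zeroʳ f ⟩
        0#                       ∎

      separate : ¬ f ≈ 0# → ∃[ e ] (¬ e ≈ 0# × e * e ≈ e × e ≤ f × Separates N e a)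
      separate f≉0 with g ≟ 0#
      ... | yes g≈0 = f , f≉0 , ff≈f , ff≈f , inj₂ (g≈0⇒fb≈f g≈0)
      ... | no  g≉0 = g , g≉0 , gg≈g , g≤f , inj₁ ga≈0

    -- Separation is inherited by smaller idempotents, so the elements can be treated one after
    -- another.
    refine : ∀ (as : List Carrier) f → f * f ≈ f → ¬ f ≈ 0# →
      ∃[ e ] (¬ e ≈ 0# × e ≤ f × All (Separates N e) as)
    refine []       f ff≈f f≉0 = f , f≉0 , ff≈f , []
    refine (a ∷ as) f ff≈f f≉0 =
      let g , g≉0 , gg≈g , g≤f , separates = separate a f ff≈f f≉0
          e , e≉0 , e≤g , all-separate     = refine as g gg≈g g≉0
      in e , e≉0 , ≤-trans e≤g g≤f , ≤-separates {N} e≤g separates ∷ all-separate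

  module Corner (e : Carrier) where

    infix 4 _≈ₑ_
    -- The corner is encoded as `R` modulo the annihilator of `e`, which for an idempotent `e` is
    -- isomorphic to `eR`. The operations of `R` stay unchanged, and `1#` becomes identified with
    -- `e`.
    _≈ₑ_ : Carrier → Carrier → Set
    x ≈ₑ y = e * x ≈ e * y

    lift : ∀ {x y} → x ≈ y → x ≈ₑ y
    lift = *-congˡ

    corner : CommutativeRing 0ℓ 0ℓ
    corner = record
      { Carrier = Carrier ; _≈_ = _≈ₑ_ ; _+_ = _+_ ; _*_ = _*_ ; -_ = -_ ; 0# = 0# ; 1# = 1#
      ; isCommutativeRing = record
        { isRing = record
          { +-isAbelianGroup = record
            { isGroup = record
              { isMonoid = record
                { isSemigroup = record
                  { isMagma = record
                    { isEquivalence = record { refl = refl ; sym = sym ; trans = trans }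
                    ; ∙-cong = λ {x} {x′} {y} {y′} x≈ y≈ →
                        trans (distribˡ e x y) (trans (+-cong x≈ y≈) (sym (distribˡ e x′ y′)))
                    }
                  ; assoc = λ x y z → lift (+-assoc x y z)
                  }
                ; identity = (λ x → lift (+-identityˡ x)) , (λ x → lift (+-identityʳ x))
                }
              ; inverse = (λ x → lift (-‿inverseˡ x)) , (λ x → lift (-‿inverseʳ x))
              ; ⁻¹-cong = λ {x} {y} x≈y → trans (sym (-‿distribʳ-* e x)) (trans (-‿cong x≈y) (-‿distribʳ-* e y))
              }
            ; comm = λ x y → lift (+-comm x y)
            }
          ; *-cong = λ {x} {x′} {y} {y′} x≈ y≈ → begin
              e * (x * y)    ≈⟨ *-assoc e x y ⟨
              (e * x) * y    ≈⟨ *-congʳ x≈ ⟩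
              (e * x′) * y   ≈⟨ solve 3 (λ e x y → e :* x :* y := x :* (e :* y)) refl e x′ y ⟩
              x′ * (e * y)   ≈⟨ *-congˡ y≈ ⟩
              x′ * (e * y′)  ≈⟨ solve 3 (λ e x y → x :* (e :* y) := e :* (x :* y)) refl e x′ y′ ⟩
              e * (x′ * y′)  ∎
          ; *-assoc = λ x y z → lift (*-assoc x y z)
          ; *-identity = (λ x → lift (*-identityˡ x)) , (λ x → lift (*-identityʳ x))
          ; distrib = (λ x y z → lift (distribˡ x y z)) , (λ x y z → lift (distribʳ x y z))
          }
        ; *-comm = λ x y → lift (*-comm x y)
        }
      }
      where open Algebra.Properties.Ring ring using (-‿distribʳ-*)

    open Algebra.Properties.Semiring.Exp (CommutativeRing.semiring corner) using () renaming (_^_ to _^ₑ_)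

    -- The two powers are not convertible: _^_ also depends on the equality of the ring.
    ^ₑ≡^ : ∀ x n → x ^ₑ n ≡ x ^ n
    ^ₑ≡^ x zero    = ≡.refl
    ^ₑ≡^ x (suc n) = ≡.cong (x *_) (^ₑ≡^ x n)

    ^ₑ-fixed : ∀ {x} n → x ^ n ≈ x → x ^ₑ n ≈ₑ x
    ^ₑ-fixed {x} n eq = lift (trans (reflexive (^ₑ≡^ x n)) eq)

    1≉0 : ¬ e ≈ 0# → ¬ 1# ≈ₑ 0#
    1≉0 e≉0 eq = e≉0 (trans (sym (*-identityʳ e)) (trans eq (zeroʳ e)))

    power-regular : ∀ m a → e * a ^ suc m ≈ e → Regular corner a
    power-regular m a inv y ay≈0 = begin
      e * y                      ≈⟨ *-congʳ inv ⟨
      e * (a * a ^ m) * y        ≈⟨ solve 4 (λ e a b y → e :* (a :* b) :* y := b :* (e :* (a :* y))) refl e a (a ^ m) y ⟩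
      a ^ m * (e * (a * y))      ≈⟨ *-congˡ ay≈0 ⟩
      a ^ m * (e * 0#)           ≈⟨ trans (*-congˡ (zeroʳ e)) (zeroʳ _) ⟩
      0#                         ≈⟨ zeroʳ e ⟨
      e * 0#                     ∎

    -- This carries regularity from the determinant `d` over to the differences of roots dividing
    -- it.
    ∣-regular : ∀ {a b} → Product._∣_ R a b → Regular corner b → Regular corner a
    ∣-regular {a} {b} (z , az≈b) reg y ay≈0 = reg y (begin
      e * (b * y)        ≈⟨ *-congˡ (*-congʳ az≈b) ⟨
      e * (a * z * y)    ≈⟨ solve 4 (λ e a z y → e :* (a :* z :* y) := z :* (e :* (a :* y))) refl e a z y ⟩
      z * (e * (a * y))  ≈⟨ *-congˡ ay≈0 ⟩
      z * (e * 0#)       ≈⟨ trans (*-congˡ (zeroʳ e)) (zeroʳ z) ⟩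
      0#                 ≈⟨ zeroʳ e ⟨
      e * 0#             ∎)

-- Finite fields formed by the roots.

record FiniteDomain (q : ℕ) : Set where
  field
    _+_ _*_           : Fin q → Fin q → Fin q
    -_                : Fin q → Fin q
    0# 1#             : Fin q
    isCommutativeRing : IsCommutativeRing _≡_ _+_ _*_ -_ 0# 1#
    cancel            : ∀ {x} → x ≢ 0# → ∀ y → x * y ≡ 0# → y ≡ 0#

  commutativeRing : CommutativeRing 0ℓ 0ℓ
  commutativeRing = record { isCommutativeRing = isCommutativeRing }

module RootDomain {p m : ℕ} (K : RootExtension p (suc (suc m)) (suc (suc m))) where
  open RootExtension K hiding (zero; refl; sym; trans)

  q : ℕ
  q = suc (suc m)

  fin : List (Fin q)
  fin = allFin q

  -- Everything that must again be a root for the roots to be closed under the ring operations.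
  results : List Carrier
  results = 0# ∷ 1# ∷ map (λ i → - root i) fin
    ++ cartesianProductWith (λ i j → root i + root j) fin fin
    ++ cartesianProductWith (λ i j → root i * root j) fin fin

  -- Once these are separated, a result either equals some root in the corner or has regular
  -- differences with all of them.
  differences : List Carrier
  differences = cartesianProductWith (λ s k → s - root k) results fin

  separating-idempotent : ∃[ e ] (¬ e ≈ 0# × e * d ^ suc m ≈ e × All (Idempotent.Separates ring (suc m) e) differences)
  separating-idempotent =
    -- Below the idempotent `d ^ (q - 1)` the determinant `d` is invertible, and this survives the
    -- refinement.
    refine _≟_ m fixed differences (d ^ suc m) (^N-idempotent _≟_ m fixed d) d^N≉0
    where
    open Idempotent ring
    open CommutativeRing ring using (trans; sym)
    d^N≉0 : ¬ d ^ suc m ≈ 0#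
    d^N≉0 eq = d≉0 (trans (sym (fixed d)) (trans (*-congˡ eq) (zeroʳ d)))

  module Roots (e : Carrier) (e≉0 : ¬ e ≈ 0#) (e≤d^N : e * d ^ suc m ≈ e)
    (sep : All (Idempotent.Separates ring (suc m) e) differences) where
    open Idempotent.Corner ring e renaming (1≉0 to e≉0⇒1≉0)
    open CommutativeRing corner using () renaming
      (_≈_ to _~_; trans to ~-trans; sym to ~-sym; refl to ~-refl;
       +-congˡ to ~+-congˡ; *-congʳ to ~*-congʳ; -‿cong to ~-‿cong)
    open Polynomial corner using (Regular; RegularDifferences; leading≈0; frobenius-coefficients; frobenius-root)
    open Algebra.Properties.AbelianGroup (CommutativeRing.+-abelianGroup corner) using () renaming (x∙y⁻¹≈ε⇒x≈y to difference≈0)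

    1≁0 : ¬ 1# ~ 0#
    1≁0 = e≉0⇒1≉0 e≉0

    root-regular : RegularDifferences root
    root-regular i≢j = ∣-regular (root-difference∣d i≢j) (power-regular m d e≤d^N)

    root-injective : ∀ {i j} → root i ~ root j → i ≡ j
    root-injective {i} {j} eq with i ≟ᶠ j
    ... | yes i≡j = i≡j
    ... | no  i≢j = contradiction (root-regular i≢j 1# (~-trans (~*-congʳ difference~0) (lift (zeroˡ 1#)))) 1≁0
      where
      difference~0 : root i - root j ~ 0#
      difference~0 = ~-trans (~+-congˡ (~-‿cong (~-sym eq))) (lift (-‿inverseʳ (root i)))

    -- Otherwise `s` and the `q` roots would be `q + 1` points with regular differences at which the
    -- monic polynomial `X^q - X` vanishes, forcing `1# ~ 0#` in the corner.
    root-exists : ∀ {s} → s ∈ results → ∃[ k ] root k ~ s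
    root-exists {s} s∈ with any? (λ k → (e * root k) ≟ (e * s))
    ... | yes found = found
    ... | no none = contradiction
      (leading≈0 1# frobenius-coefficients points points-regular (λ i → frobenius-root {m} (points i) (^ₑ-fixed q (fixed (points i)))))
      1≁0
      where
      points : Fin (suc q) → Carrier
      points zero    = s
      points (suc k) = root k
      s-regular : ∀ k → Regular (s - root k)
      s-regular k with All-lookup sep (∈-cartesianProductWith⁺ (λ s k → s - root k) s∈ (∈-allFin k))
      ... | inj₁ e*diff≈0 = contradiction
        (k , ~-sym (difference≈0 s (root k) (CommutativeRing.trans ring e*diff≈0 (CommutativeRing.sym ring (zeroʳ e))))) none
      ... | inj₂ inv  = power-regular m (s - root k) inv
      points-regular : RegularDifferences points
      points-regular {zero}  {zero}  i≢j = contradiction ≡.refl i≢j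
      points-regular {zero}  {suc j} i≢j = s-regular j
      points-regular {suc i} {zero}  i≢j = ∣-regular (∣-swap ring {s} {root i} (1# , *-identityʳ _)) (s-regular i)
      points-regular {suc i} {suc j} i≢j = root-regular (i≢j ∘ ≡.cong suc)

    zero-index : ∃[ k ] root k ~ 0#
    zero-index = root-exists (here ≡.refl)

    one-index : ∃[ k ] root k ~ 1#
    one-index = root-exists (there (here ≡.refl))

    neg-index : ∀ i → ∃[ k ] root k ~ - root i
    neg-index i = root-exists (there (there (∈-++⁺ˡ (∈-map⁺ (λ i → - root i) (∈-allFin i)))))

    sum-index : ∀ i j → ∃[ k ] root k ~ root i + root j
    sum-index i j = root-exists (there (there (∈-++⁺ʳ (map (λ i → - root i) fin)
      (∈-++⁺ˡ (∈-cartesianProductWith⁺ (λ i j → root i + root j) (∈-allFin i) (∈-allFin j))))))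

    product-index : ∀ i j → ∃[ k ] root k ~ root i * root j
    product-index i j = root-exists (there (there (∈-++⁺ʳ (map (λ i → - root i) fin)
      (∈-++⁺ʳ (cartesianProductWith (λ i j → root i + root j) fin fin)
        (∈-cartesianProductWith⁺ (λ i j → root i * root j) (∈-allFin i) (∈-allFin j))))))

    rootRawRing : RawRing 0ℓ 0ℓ
    rootRawRing = record
      { Carrier = Fin q
      ; _≈_ = _≡_
      ; _+_ = λ i j → proj₁ (sum-index i j)
      ; _*_ = λ i j → proj₁ (product-index i j)
      ; -_  = λ i → proj₁ (neg-index i)
      ; 0#  = proj₁ zero-index
      ; 1#  = proj₁ one-index
      }

    module Raw = RawRing rootRawRing
    open Algebra.Morphism.Structures.RingMorphisms rootRawRing (CommutativeRing.rawRing corner)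

    -- Through this injection the ring laws of the corner are pulled back to `Fin q`.
    root-isRingMonomorphism : IsRingMonomorphism root
    root-isRingMonomorphism = record
      { isRingHomomorphism = record
        { isSemiringHomomorphism = record
          { isNearSemiringHomomorphism = record
            { +-isMonoidHomomorphism = record
              { isMagmaHomomorphism = record
                { isRelHomomorphism = record { cong = λ { ≡.refl → ~-refl } }
                ; homo = λ i j → proj₂ (sum-index i j)
                }
              ; ε-homo = proj₂ zero-index
              }
            ; *-homo = λ i j → proj₂ (product-index i j)
            }
          ; 1#-homo = proj₂ one-index
          }
        ; -‿homo = λ i → proj₂ (neg-index i)
        }
      ; injective = root-injective
      }

    -- A nonzero `x` indexes a root other than the zero root, and the difference of these two roots
    -- is regular.
    cancel : ∀ {x} → x ≢ Raw.0# → ∀ y → x Raw.* y ≡ Raw.0# → y ≡ Raw.0#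
    cancel {x} x≢0 y xy≡0 = root-injective (~-trans (root-regular x≢0 (root y) (begin
        (root x - root Raw.0#) * root y  ≈⟨ ~*-congʳ (~+-congˡ (~-‿cong (proj₂ zero-index))) ⟩
        (root x - 0#) * root y           ≈⟨ lift (CommutativeRing.*-congʳ ring (x-0≈x (root x))) ⟩
        root x * root y                  ≈⟨ proj₂ (product-index x y) ⟨
        root (x Raw.* y)                 ≡⟨ ≡.cong root xy≡0 ⟩
        root Raw.0#                      ≈⟨ proj₂ zero-index ⟩
        0#                               ∎))
      (~-sym (proj₂ zero-index)))
      where
      open Relation.Binary.Reasoning.Setoid (CommutativeRing.setoid corner)
      x-0≈x : ∀ x → x - 0# ≈ x
      x-0≈x x = CommutativeRing.trans ring (+-congˡ ε⁻¹≈ε) (+-identityʳ x)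
        where open Algebra.Properties.AbelianGroup (CommutativeRing.+-abelianGroup ring) using (ε⁻¹≈ε)

    finiteDomain : FiniteDomain q
    finiteDomain = record
      { isCommutativeRing = Algebra.Morphism.RingMonomorphism.isCommutativeRing root-isRingMonomorphism
          (CommutativeRing.isCommutativeRing corner)
      ; cancel = cancel
      }

  roots-finiteDomain : FiniteDomain q
  roots-finiteDomain = let e , e≉0 , e≤d^N , sep = separating-idempotent in Roots.finiteDomain e e≉0 e≤d^N sep

abstract
  finiteDomain : ∀ {p e} → Prime p → 1 ℕ.≤ e → FiniteDomain (p ℕ.^ e)
  finiteDomain {p} {suc e} pr _ with p ℕ.^ suc e in eq | 1<p^e
    where
    1<p : 1 ℕ.< p
    1<p = ℕ.nonTrivial⇒n>1 p {{prime⇒nonTrivial pr}}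
    1<p^e : 1 ℕ.< p ℕ.^ suc e
    1<p^e = ℕ.<-≤-trans 1<p (ℕ.≤-trans (ℕ.≤-reflexive (≡.sym (ℕ.*-identityʳ p)))
      (ℕ.*-monoʳ-≤ p (ℕ.m^n>0 p {{prime⇒nonZero pr}} e)))
  ... | suc zero    | s≤s ()
  ... | suc (suc m) | _ = RootDomain.roots-finiteDomain (adjoin-roots (suc e) pr eq (suc (suc m)) ℕ.≤-refl)

-- Detecting arrays built from blocks.

injective⇒surjective : ∀ {n} (f : Fin n → Fin n) → (∀ {x y} → f x ≡ f y → x ≡ y) → ∀ z → ∃[ x ] f x ≡ z
injective⇒surjective {suc n} f inj z with any? (λ x → f x ≟ᶠ z)
... | yes found = found
... | no none = contradiction (injective⇒≤ {f = λ x → punchOut (missed x)}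
    (λ {x} {y} eq → inj (punchOut-injective (missed x) (missed y) eq))) (ℕ.<⇒≱ ℕ.≤-refl)
  where
  missed : ∀ x → z ≢ f x
  missed x z≡fx = none (x , ≡.sym z≡fx)

funToFin-cong : ∀ {m n} {f g : Fin m → Fin n} → (∀ i → f i ≡ g i) → funToFin f ≡ funToFin g
funToFin-cong {zero}  f≗g = ≡.refl
funToFin-cong {suc m} f≗g = ≡.cong₂ combine (f≗g zero) (funToFin-cong (f≗g ∘ suc))

finToFun-injective : ∀ {m n} {x y : Fin (n ℕ.^ m)} → (∀ i → finToFun x i ≡ finToFun y i) → x ≡ y
finToFun-injective {m} {n} {x} {y} eq = ≡.trans (≡.sym (funToFin-finToFin {m} {n} x))
  (≡.trans (funToFin-cong {m} eq) (funToFin-finToFin {m} {n} y))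

lookup-extensional : ∀ {A : Set} {n} {x y : Vec.Vec A n} → (∀ i → Vec.lookup x i ≡ Vec.lookup y i) → x ≡ y
lookup-extensional {x = x} {y} eq = ≡.trans (≡.sym (Vec.tabulate∘lookup x))
  (≡.trans (Vec.tabulate-cong eq) (Vec.tabulate∘lookup y))

_≟ᴵ_ : ∀ {k v t} (S T : Interaction k v t) → Dec (S ≡ T)
interaction i x ≟ᴵ interaction j y = map′
  (λ { (≡.refl , ≡.refl) → ≡.refl }) (λ { ≡.refl → ≡.refl , ≡.refl })
  ((i ≟ᶠ j) ×-dec Vec.≡-dec _≟ᶠ_ x y)

module BlockArray {d t k q : ℕ} (F : Fin (d ℕ.+ 1) → (Fin t → Fin q) → Fin k → Fin q)
  (block-injective : ∀ i c a a′ → (∀ (j : Fin t) → F c a (column i j) ≡ F c a′ (column i j)) → ∀ l → a l ≡ a′ l)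
  (blocks-separated : ∀ {i i′} → i ≢ i′ → ∀ c c′ a a′ →
    (∀ (j : Fin t) → F c a (column i j) ≡ F c′ a′ (column i j)) →
    (∀ (j : Fin t) → F c a (column i′ j) ≡ F c′ a′ (column i′ j)) → c ≡ c′)
  where

  array : Array ((d ℕ.+ 1) ℕ.* q ℕ.^ t) k q
  array r = let c , a = remQuot {d ℕ.+ 1} (q ℕ.^ t) r in F c (finToFun a)

  array-combine : ∀ c a l → array (combine c a) l ≡ F c (finToFun a) l
  array-combine c a l = ≡.cong (λ (c , a) → F c (finToFun a) l) (remQuot-combine c a)

  window : Fin (suc k ℕ.∸ t) → Fin (d ℕ.+ 1) → Fin (q ℕ.^ t) → Fin t → Fin q
  window i c a j = F c (finToFun a) (column i j)

  -- Parameters and window contents are both coded in `Fin (q ^ t)`. Thus injectivity on a window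
  -- implies that each tuple occurs there.
  restrict : Fin (suc k ℕ.∸ t) → Fin (d ℕ.+ 1) → Fin (q ℕ.^ t) → Fin (q ℕ.^ t)
  restrict i c a = funToFin (window i c a)

  restrict-injective : ∀ i c {a a′} → restrict i c a ≡ restrict i c a′ → a ≡ a′
  restrict-injective i c {a} {a′} eq = finToFun-injective {t} (block-injective i c _ _ (λ j → begin
    window i c a j                ≡⟨ finToFun-funToFin (window i c a) j ⟨
    finToFun (restrict i c a) j   ≡⟨ ≡.cong (λ y → finToFun {q} {t} y j) eq ⟩
    finToFun (restrict i c a′) j  ≡⟨ finToFun-funToFin (window i c a′) j ⟩
    window i c a′ j               ∎))
    where open ≡.≡-Reasoning

  cover : ∀ (T : Interaction k q t) c → ∃[ a ] (∀ j → window (start T) c a j ≡ Vec.lookup (values T) j)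
  cover T c with injective⇒surjective (restrict (start T) c) (restrict-injective (start T) c) (funToFin (Vec.lookup (values T)))
  ... | a , eq = a , λ j → begin
    window (start T) c a j                        ≡⟨ finToFun-funToFin (window (start T) c a) j ⟨
    finToFun (restrict (start T) c a) j           ≡⟨ ≡.cong (λ y → finToFun {q} {t} y j) eq ⟩
    finToFun (funToFin (Vec.lookup (values T))) j ≡⟨ finToFun-funToFin (Vec.lookup (values T)) j ⟩
    Vec.lookup (values T) j                       ∎
    where open ≡.≡-Reasoning

  row : Interaction k q t → Fin (d ℕ.+ 1) → Fin ((d ℕ.+ 1) ℕ.* q ℕ.^ t)
  row T c = combine c (proj₁ (cover T c))

  row∈ρ : ∀ T c → ρ array T (row T c)
  row∈ρ T c j = ≡.trans (array-combine c (proj₁ (cover T c)) _) (proj₂ (cover T c) j)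

  -- With equal starts, one shared row already determines the values of both interactions. With
  -- different starts, the two rows would agree on two windows although they lie in different
  -- blocks.
  shared-rows : ∀ T T′ {c c′} → ρ array T′ (row T c) → ρ array T′ (row T c′) → c ≢ c′ → T ≡ T′
  shared-rows T T′ {c} {c′} r∈ r′∈ c≢c′ with start T ≟ᶠ start T′
  ... | yes ≡.refl = ≡.cong (interaction (start T))
    (lookup-extensional (λ j → ≡.trans (≡.sym (row∈ρ T c j)) (r∈ j)))
  ... | no starts≢ = contradiction
    (blocks-separated starts≢ c c′ _ _
      (agree T (row∈ρ T c) (row∈ρ T c′)) (agree T′ r∈ r′∈)) c≢c′
    where
    agree : ∀ S → ρ array S (row T c) → ρ array S (row T c′) → ∀ j →
      F c (finToFun (proj₁ (cover T c))) (column (start S) j) ≡ F c′ (finToFun (proj₁ (cover T c′))) (column (start S) j)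
    agree S p p′ j = ≡.trans (≡.sym (array-combine c _ _))
      (≡.trans (p j) (≡.trans (≡.sym (p′ j)) (array-combine c′ _ _)))

  -- If `T` is not listed, assign to each of its `d + 1` chosen rows a member of `𝒯` containing it.
  -- Two rows get the same member by the pigeonhole principle, and that member must be `T`.
  detected : ∀ 𝒯 → length 𝒯 ≡ d → ∀ T → (∀ {r} → ρ array T r → ρ⋃ array 𝒯 r) → T ∈ 𝒯
  detected 𝒯 len T ρ⊆ with any?ˡ (T ≟ᴵ_) 𝒯
  ... | yes T∈𝒯 = T∈𝒯
  ... | no  T∉𝒯 =
    let c , c′ , c<c′ , index≡ = pigeonhole 𝒯<d+1 (index ∘ proj₁ ∘ proj₂ ∘ hit)
        T′ , T′∈ , r∈   = hit c
        T″ , T″∈ , r′∈  = hit c′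
        T″≡T′ = ≡.trans (lookup-index T″∈) (≡.trans (≡.cong (lookup 𝒯) (≡.sym index≡)) (≡.sym (lookup-index T′∈)))
        T≡T′ = shared-rows T T′ r∈ (≡.subst (λ S → ρ array S (row T c′)) T″≡T′ r′∈) (<⇒≢ c<c′)
    in contradiction (≡.subst (_∈ 𝒯) (≡.sym T≡T′) T′∈) T∉𝒯
    where
    hit : ∀ c → ρ⋃ array 𝒯 (row T c)
    hit c = ρ⊆ (row∈ρ T c)
    𝒯<d+1 : length 𝒯 ℕ.< d ℕ.+ 1
    𝒯<d+1 = ℕ.≤-reflexive (≡.trans (≡.cong suc len) (ℕ.+-comm 1 d))

  optimum : OptimumCDA d t ((d ℕ.+ 1) ℕ.* q ℕ.^ t) k q
  optimum = (array , record
    { covering  = λ i x → row (interaction i x) block , row∈ρ (interaction i x) block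
    ; detecting = λ 𝒯 _ len T → mk⇔ (detected 𝒯 len T) (λ T∈𝒯 r∈ → T , T∈𝒯 , r∈)
    }) , ≡.refl
    where
    block : Fin (d ℕ.+ 1)
    block = fromℕ< (ℕ.≤-trans (s≤s z≤n) (ℕ.m≤n+m 1 d))

-- The array of polynomial values at cyclically ordered points.

toℕ-column : ∀ {k t} (i : Fin (suc k ℕ.∸ t)) j → toℕ (column {k} {t} i j) ≡ toℕ i ℕ.+ toℕ j
toℕ-column i j = toℕ-fromℕ< _

mod≡⇒%≡ : ∀ {m n q} .{{_ : NonZero q}} → m mod q ≡ n mod q → m % q ≡ n % q
mod≡⇒%≡ eq = ≡.trans (≡.sym (toℕ-fromℕ< _)) (≡.trans (≡.cong toℕ eq) (toℕ-fromℕ< _))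

-- Adding `i * (q - 1)` to `i + x` gives `x + i * q`, so `x` is recovered from the residue of
-- `i + x`.
+-mod-injective : ∀ {q} .{{_ : NonZero q}} i {m n} → m ℕ.< q → n ℕ.< q → (i ℕ.+ m) mod q ≡ (i ℕ.+ n) mod q → m ≡ n
+-mod-injective {q} i {m} {n} m<q n<q eq = ≡.trans (recover m m<q) (≡.trans
  (≡.cong (λ x → (i ℕ.* ℕ.pred q % q ℕ.+ x) % q) (mod≡⇒%≡ {i ℕ.+ m} {i ℕ.+ n} eq)) (≡.sym (recover n n<q)))
  where
  open ≡.≡-Reasoning
  recover : ∀ x → x ℕ.< q → x ≡ (i ℕ.* ℕ.pred q % q ℕ.+ (i ℕ.+ x) % q) % q
  recover x x<q = begin
    x                                              ≡⟨ m<n⇒m%n≡m x<q ⟨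
    x % q                                          ≡⟨ [m+kn]%n≡m%n x i q ⟨
    (x ℕ.+ i ℕ.* q) % q                            ≡⟨ ≡.cong (λ y → (x ℕ.+ i ℕ.* y) % q) (ℕ.suc-pred q) ⟨
    (x ℕ.+ i ℕ.* suc (ℕ.pred q)) % q               ≡⟨ ≡.cong (λ y → (x ℕ.+ y) % q) (ℕ.*-suc i (ℕ.pred q)) ⟩
    (x ℕ.+ (i ℕ.+ i ℕ.* ℕ.pred q)) % q             ≡⟨ ≡.cong (_% q)
      (≡.trans (≡.sym (ℕ.+-assoc x i _)) (≡.trans (ℕ.+-comm (x ℕ.+ i) _) (≡.cong (i ℕ.* ℕ.pred q ℕ.+_) (ℕ.+-comm x i)))) ⟩
    (i ℕ.* ℕ.pred q ℕ.+ (i ℕ.+ x)) % q             ≡⟨ %-distribˡ-+ (i ℕ.* ℕ.pred q) (i ℕ.+ x) q ⟩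
    (i ℕ.* ℕ.pred q % q ℕ.+ (i ℕ.+ x) % q) % q     ∎

module DomainProperties {q : ℕ} (D : FiniteDomain q) where
  open FiniteDomain D using (commutativeRing; cancel) public
  open CommutativeRing commutativeRing hiding (zero; refl; sym; trans)
  open Algebra.Properties.AbelianGroup +-abelianGroup using (x∙y⁻¹≈ε⇒x≈y)
  open Polynomial commutativeRing

  difference≡0⇒≡ : ∀ {x y} → x - y ≡ 0# → x ≡ y
  difference≡0⇒≡ = x∙y⁻¹≈ε⇒x≈y _ _

  ≡⇒difference≡0 : ∀ {x y} → x ≡ y → x - y ≡ 0#
  ≡⇒difference≡0 {x} ≡.refl = -‿inverseʳ x

  difference-regular : ∀ {x y} → x ≢ y → Regular (x - y)
  difference-regular x≢y = cancel (λ eq → x≢y (difference≡0⇒≡ eq))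

module PolynomialArray {q d t : ℕ} (D : FiniteDomain q) (d<q : d ℕ.< q) (0<t : 0 ℕ.< t) (t<q : t ℕ.< q) where
  open DomainProperties D
  open CommutativeRing commutativeRing using (_-_; 0#; -‿inverseʳ)
  open Polynomial commutativeRing

  instance
    q-nonZero : NonZero q
    q-nonZero = ℕ.>-nonZero (ℕ.≤-<-trans z≤n d<q)

  k : ℕ
  k = q ℕ.+ t ℕ.∸ 1

  leading : Fin (d ℕ.+ 1) → Fin q
  leading c = inject≤ c (ℕ.≤-trans (ℕ.≤-reflexive (ℕ.+-comm d 1)) d<q)

  -- The columns run once through all `q` points and then repeat the first `t - 1` of them, so there
  -- is one window for each starting point.
  F : Fin (d ℕ.+ 1) → (Fin t → Fin q) → Fin k → Fin q
  F c a l = eval (leading c) a (toℕ l mod q)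

  window : ℕ → ℕ → Fin q
  window i n = (i ℕ.+ n) mod q

  window-regular : ∀ i {n} (offset : Fin n → ℕ) →
    (∀ j → offset j ℕ.< q) → (∀ {j j′} → offset j ≡ offset j′ → j ≡ j′) →
    RegularDifferences (window i ∘ offset)
  window-regular i offset offset<q offset-injective {j} {j′} j≢j′ = difference-regular
    (λ eq → j≢j′ (offset-injective (+-mod-injective i (offset<q j) (offset<q j′) eq)))

  F-column : ∀ c a (i : Fin (suc k ℕ.∸ t)) j → F c a (column i j) ≡ eval (leading c) a (window (toℕ i) (toℕ j))
  F-column c a i j = ≡.cong (λ n → eval (leading c) a (n mod q)) (toℕ-column {k} {t} i j)

  difference-root : ∀ c c′ a a′ (i : Fin (suc k ℕ.∸ t)) j → F c a (column i j) ≡ F c′ a′ (column i j) →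
    eval (leading c - leading c′) (λ l → a l - a′ l) (window (toℕ i) (toℕ j)) ≡ 0#
  difference-root c c′ a a′ i j eq = ≡.trans (eval-difference _ _ a a′ _)
    (≡⇒difference≡0 (≡.trans (≡.sym (F-column c a i j)) (≡.trans eq (F-column c′ a′ i j))))

  -- Within a block the leading terms cancel: the difference has degree below `t` and vanishes at
  -- the `t` distinct points of the window.
  block-injective : ∀ i c a a′ → (∀ (j : Fin t) → F c a (column i j) ≡ F c a′ (column i j)) → ∀ l → a l ≡ a′ l
  block-injective i c a a′ agree l = difference≡0⇒≡ (coefficients≈0 (leading c - leading c) _ (window (toℕ i) ∘ toℕ)
    (-‿inverseʳ (leading c)) (window-regular (toℕ i) toℕ (λ j → ℕ.<-trans (toℕ<n j) t<q) toℕ-injective)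
    (λ j → difference-root c c a a′ i j (agree j)) l)

  start<q : (i : Fin (suc k ℕ.∸ t)) → toℕ i ℕ.< q
  start<q i = ≡.subst (toℕ i ℕ.<_) windows≡q (toℕ<n i)
    where
    windows≡q : suc k ℕ.∸ t ≡ q
    windows≡q = ≡.trans (≡.cong (ℕ._∸ t) (ℕ.m+[n∸m]≡n (ℕ.≤-trans 0<t (ℕ.m≤n+m t q)))) (ℕ.m+n∸n≡m q t)

  -- The difference of the two polynomials has degree at most `t`. Its roots include the first
  -- window and one further point of the second, so its leading coefficient vanishes.
  separated-< : ∀ (i i′ : Fin (suc k ℕ.∸ t)) → toℕ i ℕ.< toℕ i′ → ∀ c c′ a a′ →
    (∀ (j : Fin t) → F c a (column i j) ≡ F c′ a′ (column i j)) →
    (∀ (j : Fin t) → F c a (column i′ j) ≡ F c′ a′ (column i′ j)) → c ≡ c′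
  separated-< i i′ i<i′ c c′ a a′ agree agree′ = inject≤-injective _ _ c c′ (difference≡0⇒≡
    (leading≈0 (leading c - leading c′) _ (window (toℕ i) ∘ offset) (window-regular (toℕ i) offset offset<q offset-injective) root))
    where
    s : ℕ
    s = toℕ i′ ℕ.∸ toℕ i
    s<q : s ℕ.< q
    s<q = ℕ.≤-<-trans (ℕ.m∸n≤m (toℕ i′) (toℕ i)) (start<q i′)
    t∸s<t : t ℕ.∸ s ℕ.< t
    t∸s<t = ℕ.m<n+o⇒m∸n<o t s {{ℕ.>-nonZero 0<t}} (ℕ.m<n+m t (ℕ.m<n⇒0<n∸m i<i′))
    -- The position t ∸ s of the second window has offset max s t from i,
    -- which lies outside the first window and does not wrap around to it.
    offset : Fin (suc t) → ℕ
    offset zero    = s ℕ.+ (t ℕ.∸ s)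
    offset (suc j) = toℕ j
    t≤offset : t ℕ.≤ offset zero
    t≤offset = ℕ.m≤n+m∸n t s
    offset<q : ∀ j → offset j ℕ.< q
    offset<q zero with ℕ.≤-total s t
    ... | inj₁ s≤t = ≡.subst (ℕ._< q) (≡.sym (ℕ.m+[n∸m]≡n s≤t)) t<q
    ... | inj₂ t≤s = ≡.subst (ℕ._< q)
      (≡.sym (≡.trans (≡.cong (s ℕ.+_) (ℕ.m≤n⇒m∸n≡0 t≤s)) (ℕ.+-identityʳ s))) s<q
    offset<q (suc j) = ℕ.<-trans (toℕ<n j) t<q
    offset-injective : ∀ {j j′} → offset j ≡ offset j′ → j ≡ j′
    offset-injective {zero}  {zero}   eq = ≡.refl
    offset-injective {zero}  {suc j′} eq = contradiction (≡.sym eq) (ℕ.<⇒≢ (ℕ.<-≤-trans (toℕ<n j′) t≤offset))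
    offset-injective {suc j} {zero}   eq = contradiction eq (ℕ.<⇒≢ (ℕ.<-≤-trans (toℕ<n j) t≤offset))
    offset-injective {suc j} {suc j′} eq = ≡.cong suc (toℕ-injective eq)
    position : toℕ i′ ℕ.+ toℕ (fromℕ< t∸s<t) ≡ toℕ i ℕ.+ offset zero
    position = ≡.trans (≡.cong₂ ℕ._+_ (≡.sym (ℕ.m+[n∸m]≡n (ℕ.<⇒≤ i<i′))) (toℕ-fromℕ< t∸s<t)) (ℕ.+-assoc (toℕ i) s (t ℕ.∸ s))
    root : ∀ j → eval (leading c - leading c′) (λ l → a l - a′ l) (window (toℕ i) (offset j)) ≡ 0#
    root zero    = ≡.trans (≡.cong (λ n → eval (leading c - leading c′) (λ l → a l - a′ l) (n mod q)) (≡.sym position))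
      (difference-root c c′ a a′ i′ (fromℕ< t∸s<t) (agree′ (fromℕ< t∸s<t)))
    root (suc j) = difference-root c c′ a a′ i j (agree j)

  blocks-separated : ∀ {i i′} → i ≢ i′ → ∀ c c′ a a′ →
    (∀ (j : Fin t) → F c a (column i j) ≡ F c′ a′ (column i j)) →
    (∀ (j : Fin t) → F c a (column i′ j) ≡ F c′ a′ (column i′ j)) → c ≡ c′
  blocks-separated {i} {i′} i≢i′ c c′ a a′ agree agree′ with ℕ.<-cmp (toℕ i) (toℕ i′)
  ... | tri< i<i′ _ _ = separated-< i i′ i<i′ c c′ a a′ agree agree′
  ... | tri≈ _ i≡i′ _ = contradiction (toℕ-injective i≡i′) i≢i′
  ... | tri> _ _ i′<i = separated-< i′ i i′<i c c′ a a′ agree′ agree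

  optimum : OptimumCDA d t ((d ℕ.+ 1) ℕ.* q ℕ.^ t) k q
  optimum = BlockArray.optimum F block-injective blocks-separated

-- Joins of points in the affine plane.

module AffinePlane (R : CommutativeRing 0ℓ 0ℓ) where
  open CommutativeRing R
  open IntegerCoefficientSolver R
  open Polynomial R using (Regular; -‿zero)

  Point : Set
  Point = Carrier × Carrier

  -- The determinant with rows (c , a , b), (1 , P) and (1 , Q).
  join : Point → Point → Carrier → Carrier → Carrier → Carrier
  join (p₁ , p₂) (q₁ , q₂) c a b = c * (p₁ * q₂ - p₂ * q₁) - a * (q₂ - p₂) + b * (q₁ - p₁)

  join-difference : ∀ P Q c c′ a a′ b b′ →
    join P Q (c - c′) (a - a′) (b - b′) ≈ join P Q c a b - join P Q c′ a′ b′
  join-difference (p₁ , p₂) (q₁ , q₂) c c′ a a′ b b′ =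
    solve 9 (λ x y z c c′ a a′ b b′ →
      (c :- c′) :* x :- (a :- a′) :* y :+ (b :- b′) :* z :=
      (c :* x :- a :* y :+ b :* z) :- (c′ :* x :- a′ :* y :+ b′ :* z)) refl
      (p₁ * q₂ - p₂ * q₁) (q₂ - p₂) (q₁ - p₁) c c′ a a′ b b′

  area : Point → Point → Point → Carrier
  area (p₁ , p₂) (q₁ , q₂) (s₁ , s₂) = (q₁ - p₁) * (s₂ - q₂) - (q₂ - p₂) * (s₁ - q₁)

  -- In the translated coordinates `α` and `β`, with `Q` as origin, both joins lose their `c` term.
  -- The resulting 2 by 2 system has determinant `area P Q S` up to sign, and Cramer's rule solves
  -- it.
  joins-meet : ∀ P Q S c a b → Regular (area P Q S) → join P Q c a b ≈ 0# → join Q S c a b ≈ 0# →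
    a - c * proj₁ Q ≈ 0# × b - c * proj₂ Q ≈ 0#
  joins-meet (p₁ , p₂) (q₁ , q₂) (s₁ , s₂) c a b reg PQ≈0 QS≈0 =
    reg α (trans (solve 6 (λ u v u′ v′ α β → (u :* v′ :- v :* u′) :* α := u′ :* (β :* u :- α :* v) :- u :* (β :* u′ :- α :* v′))
      refl u v u′ v′ α β) (-‿zero (times u′ PQ) (times u QS))) ,
    reg β (trans (solve 6 (λ u v u′ v′ α β → (u :* v′ :- v :* u′) :* β := v′ :* (β :* u :- α :* v) :- v :* (β :* u′ :- α :* v′))
      refl u v u′ v′ α β) (-‿zero (times v′ PQ) (times v QS)))
    where
    α β u v u′ v′ : Carrier
    α = a - c * q₁
    β = b - c * q₂
    u = q₁ - p₁
    v = q₂ - p₂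
    u′ = s₁ - q₁
    v′ = s₂ - q₂
    times : ∀ x {y} → y ≈ 0# → x * y ≈ 0#
    times x y≈0 = trans (*-congˡ y≈0) (zeroʳ x)
    PQ : β * u - α * v ≈ 0#
    PQ = trans (solve 7 (λ p₁ p₂ q₁ q₂ a b c →
      (b :- c :* q₂) :* (q₁ :- p₁) :- (a :- c :* q₁) :* (q₂ :- p₂) :=
      c :* (p₁ :* q₂ :- p₂ :* q₁) :- a :* (q₂ :- p₂) :+ b :* (q₁ :- p₁)) refl p₁ p₂ q₁ q₂ a b c) PQ≈0
    QS : β * u′ - α * v′ ≈ 0#
    QS = trans (solve 7 (λ q₁ q₂ s₁ s₂ a b c →
      (b :- c :* q₂) :* (s₁ :- q₁) :- (a :- c :* q₁) :* (s₂ :- q₂) :=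
      c :* (q₁ :* s₂ :- q₂ :* s₁) :- a :* (s₂ :- q₂) :+ b :* (s₁ :- q₁)) refl q₁ q₂ s₁ s₂ a b c) QS≈0

  multiples-agree : ∀ {a c x y} → a - c * x ≈ 0# → a - c * y ≈ 0# → (x - y) * c ≈ 0#
  multiples-agree {a} {c} {x} {y} eq eq′ = trans
    (solve 4 (λ a c x y → (x :- y) :* c := (a :- c :* y) :- (a :- c :* x)) refl a c x y) (-‿zero eq′ eq)

-- Halves, parities and the array of joins.

half< : ∀ {n m} → n ℕ.< m ℕ.+ m → ⌊ n /2⌋ ℕ.< m
half< {n} {m} n<m+m = ℕ.≰⇒> λ m≤half → ℕ.<⇒≱ n<m+m (ℕ.≤-trans
  (ℕ.+-mono-≤ m≤half (ℕ.≤-trans m≤half (ℕ.⌊n/2⌋≤⌈n/2⌉ n))) (ℕ.≤-reflexive (ℕ.⌊n/2⌋+⌈n/2⌉≡n n)))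

parity : ℕ → ℕ
parity zero          = 0
parity (suc zero)    = 1
parity (suc (suc n)) = parity n

parity<2 : ∀ n → parity n ℕ.< 2
parity<2 zero          = s≤s z≤n
parity<2 (suc zero)    = s≤s (s≤s z≤n)
parity<2 (suc (suc n)) = parity<2 n

parity-suc : ∀ n → (⌊ suc n /2⌋ ≡ ⌊ n /2⌋ × parity n ≡ 0 × parity (suc n) ≡ 1)
  ⊎ (⌊ suc n /2⌋ ≡ suc ⌊ n /2⌋ × parity n ≡ 1 × parity (suc n) ≡ 0)
parity-suc zero       = inj₁ (≡.refl , ≡.refl , ≡.refl)
parity-suc (suc zero) = inj₂ (≡.refl , ≡.refl , ≡.refl)
parity-suc (suc (suc n)) with parity-suc n
... | inj₁ (half , even , odd) = inj₁ (≡.cong suc half , even , odd)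
... | inj₂ (half , odd , even) = inj₂ (≡.cong suc half , odd , even)

half-parity-injective : ∀ m n → ⌊ m /2⌋ ≡ ⌊ n /2⌋ → parity m ≡ parity n → m ≡ n
half-parity-injective zero          zero          _  _  = ≡.refl
half-parity-injective (suc zero)    (suc zero)    _  _  = ≡.refl
half-parity-injective zero          (suc zero)    _  ()
half-parity-injective (suc zero)    zero          _  ()
half-parity-injective (suc (suc m)) (suc (suc n)) eq eq′ =
  ≡.cong (λ n → suc (suc n)) (half-parity-injective m n (ℕ.suc-injective eq) eq′)

binary-injective : ∀ {a a′ b b′} → b ℕ.< 2 → b′ ℕ.< 2 → 2 ℕ.* a ℕ.+ b ≡ 2 ℕ.* a′ ℕ.+ b′ → a ≡ a′ × b ≡ b′
binary-injective {a} {a′} {zero} {zero} _ _ eq =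
  ℕ.*-cancelˡ-≡ a a′ 2 (ℕ.+-cancelʳ-≡ 0 (2 ℕ.* a) (2 ℕ.* a′) eq) , ≡.refl
binary-injective {a} {a′} {suc zero} {suc zero} _ _ eq =
  ℕ.*-cancelˡ-≡ a a′ 2 (ℕ.+-cancelʳ-≡ 1 (2 ℕ.* a) (2 ℕ.* a′) eq) , ≡.refl
binary-injective {a} {a′} {zero} {suc zero} _ _ eq =
  contradiction (≡.trans (≡.sym (ℕ.+-identityʳ _)) (≡.trans eq (ℕ.+-comm _ 1))) (ℕ.even≢odd a a′)
binary-injective {a} {a′} {suc zero} {zero} _ _ eq =
  contradiction (≡.trans (≡.sym (ℕ.+-identityʳ _)) (≡.trans (≡.sym eq) (ℕ.+-comm _ 1))) (ℕ.even≢odd a′ a)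
binary-injective {b = suc (suc _)} (s≤s (s≤s ())) _ _
binary-injective {b′ = suc (suc _)} _ (s≤s (s≤s ())) _

module JoinArray {q d : ℕ} (D : FiniteDomain q) (d<q : d ℕ.< q) (4≤q : 4 ℕ.≤ q) where
  open DomainProperties D
  open CommutativeRing commutativeRing using (_-_; 0#; -‿inverseʳ) renaming (_*_ to _·_)
  open Polynomial commutativeRing using (Regular)
  open AffinePlane commutativeRing

  instance
    q-nonZero : NonZero q
    q-nonZero = ℕ.>-nonZero (ℕ.≤-<-trans z≤n d<q)

  k : ℕ
  k = 2 ℕ.* q ℕ.+ 3

  -- The points 2n and 2n + 1 form a vertical pair, and consecutive pairs
  -- lie on different vertical lines; so no three consecutive points are collinear.
  abscissa ordinate : ℕ → Fin q
  abscissa n = ⌊ n /2⌋ mod q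
  ordinate n = (2 ℕ.* (⌊ n /2⌋ / q) ℕ.+ parity n) mod q

  point : ℕ → Point
  point n = abscissa n , ordinate n

  suc-mod≢ : ∀ n → suc n mod q ≢ n mod q
  suc-mod≢ n eq = contradiction (+-mod-injective n (ℕ.≤-trans (s≤s (s≤s z≤n)) 4≤q) (ℕ.≤-trans (s≤s z≤n) 4≤q)
    (≡.trans (≡.cong (_mod q) (ℕ.+-comm n 1)) (≡.trans eq (≡.cong (_mod q) (≡.sym (ℕ.+-identityʳ n)))))) (λ ())

  ordinate≢ : ∀ m n → ⌊ m /2⌋ ≡ ⌊ n /2⌋ → parity m ≢ parity n → ordinate m ≢ ordinate n
  ordinate≢ m n half≡ parity≢ eq = parity≢ (+-mod-injective (2 ℕ.* (⌊ n /2⌋ / q)) (parity<q m) (parity<q n)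
    (≡.trans (≡.cong (λ h → (2 ℕ.* (h / q) ℕ.+ parity m) mod q) (≡.sym half≡)) eq))
    where
    parity<q : ∀ n → parity n ℕ.< q
    parity<q n = ℕ.<-≤-trans (parity<2 n) (ℕ.≤-trans (s≤s (s≤s z≤n)) 4≤q)

  product≢0 : ∀ {x y} → x ≢ 0# → y ≢ 0# → x · y ≢ 0#
  product≢0 x≢0 y≢0 xy≡0 = y≢0 (cancel x≢0 _ xy≡0)

  difference≢0 : ∀ {x y} → x ≢ y → x - y ≢ 0#
  difference≢0 x≢y eq = x≢y (difference≡0⇒≡ eq)

  zero-product : ∀ {x} y → x ≡ 0# → x · y ≡ 0#
  zero-product y ≡.refl = CommutativeRing.zeroˡ commutativeRing y

  -- Of the two steps between the three points exactly one is vertical, so exactly one of the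
  -- products `u · v′` and `v · u′` is zero.
  noncollinear : ∀ n → Regular (area (point n) (point (suc n)) (point (suc (suc n))))
  noncollinear n = cancel (λ eq → area≢0 (difference≡0⇒≡ eq))
    where
    u v u′ v′ : Fin q
    u = abscissa (suc n) - abscissa n
    v = ordinate (suc n) - ordinate n
    u′ = abscissa (suc (suc n)) - abscissa (suc n)
    v′ = ordinate (suc (suc n)) - ordinate (suc n)
    area≢0 : u · v′ ≢ v · u′
    area≢0 with parity-suc n
    ... | inj₁ (half , even , odd) = λ eq → product≢0 v≢0 u′≢0 (≡.trans (≡.sym eq) (zero-product v′ u≡0))
      where
      u≡0 : u ≡ 0#
      u≡0 = ≡⇒difference≡0 (≡.cong (_mod q) half)
      v≢0 : v ≢ 0#
      v≢0 = difference≢0 (ordinate≢ (suc n) n half (λ eq → contradiction (≡.trans (≡.sym odd) (≡.trans eq even)) λ ()))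
      u′≢0 : u′ ≢ 0#
      u′≢0 = difference≢0 (λ eq → suc-mod≢ ⌊ n /2⌋ (≡.trans eq (≡.cong (_mod q) half)))
    ... | inj₂ (half , odd , even) = λ eq → product≢0 u≢0 v′≢0 (≡.trans eq
        (≡.trans (CommutativeRing.*-comm commutativeRing v u′) (zero-product v u′≡0)))
      where
      u′≡0 : u′ ≡ 0#
      u′≡0 = ≡⇒difference≡0 (≡.cong (_mod q) (≡.sym half))
      u≢0 : u ≢ 0#
      u≢0 = difference≢0 (λ eq → suc-mod≢ ⌊ n /2⌋ (≡.trans (≡.cong (_mod q) (≡.sym half)) eq))
      v′≢0 : v′ ≢ 0#
      v′≢0 = difference≢0 (ordinate≢ (suc (suc n)) (suc n) (≡.sym half)
        (λ eq → contradiction (≡.trans (≡.sym odd) (≡.trans eq even)) λ ()))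

  -- The abscissa gives the half of the index modulo `q`. The ordinate has the two binary digits
  -- `⌊ n /2⌋ / q` and `parity n`, and does not wrap around because `4 ≤ q`. Together they determine
  -- the index.
  point-injective : ∀ {m n} → m ℕ.< 2 ℕ.* q ℕ.+ 4 → n ℕ.< 2 ℕ.* q ℕ.+ 4 → point m ≡ point n → m ≡ n
  point-injective {m} {n} m< n< eq = half-parity-injective m n
    (≡.trans (m≡m%n+[m/n]*n ⌊ m /2⌋ q) (≡.trans (≡.cong₂ (λ r s → r ℕ.+ s ℕ.* q)
      (mod≡⇒%≡ {⌊ m /2⌋} {⌊ n /2⌋} (≡.cong proj₁ eq)) (proj₁ digits)) (≡.sym (m≡m%n+[m/n]*n ⌊ n /2⌋ q))))
    (proj₂ digits)
    where
    -- The index is below `4 q`, so its half passes through the residues modulo `q` at most twice.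
    quotient<2 : ∀ {n} → n ℕ.< 2 ℕ.* q ℕ.+ 4 → ⌊ n /2⌋ / q ℕ.< 2
    quotient<2 {n} n< = m<n*o⇒m/o<n {⌊ n /2⌋} {2} {q} (half< (ℕ.<-≤-trans n<
      (ℕ.+-monoʳ-≤ (2 ℕ.* q) (ℕ.≤-trans 4≤q (ℕ.m≤m+n q (q ℕ.+ 0))))))
    code : ℕ → ℕ
    code n = 2 ℕ.* (⌊ n /2⌋ / q) ℕ.+ parity n
    code<q : ∀ {n} → n ℕ.< 2 ℕ.* q ℕ.+ 4 → code n ℕ.< q
    code<q {n} n< = ℕ.<-≤-trans (ℕ.+-mono-≤-< (ℕ.*-monoʳ-≤ 2 (ℕ.≤-pred (quotient<2 n<))) (parity<2 n)) 4≤q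
    digits : ⌊ m /2⌋ / q ≡ ⌊ n /2⌋ / q × parity m ≡ parity n
    digits = binary-injective (parity<2 m) (parity<2 n) (+-mod-injective 0 (code<q m<) (code<q n<) (≡.cong proj₂ eq))

  -- Here `(a , b)` is `c` times each point, so `c` kills both coordinates of `P - Q`, one of which
  -- is nonzero.
  common-multiple : ∀ {P Q : Point} {a b c} → P ≢ Q →
    a - c · proj₁ P ≡ 0# × b - c · proj₂ P ≡ 0# → a - c · proj₁ Q ≡ 0# × b - c · proj₂ Q ≡ 0# → c ≡ 0#
  common-multiple {p₁ , p₂} {q₁ , q₂} P≢Q (a≡ , b≡) (a≡′ , b≡′) with p₁ ≟ᶠ q₁ | p₂ ≟ᶠ q₂
  ... | no p₁≢q₁ | _        = difference-regular p₁≢q₁ _ (multiples-agree a≡ a≡′)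
  ... | yes _    | no p₂≢q₂ = difference-regular p₂≢q₂ _ (multiples-agree b≡ b≡′)
  ... | yes p₁≡q₁ | yes p₂≡q₂ = contradiction (≡.cong₂ _,_ p₁≡q₁ p₂≡q₂) P≢Q

  scalar : Fin (d ℕ.+ 1) → Fin q
  scalar c = inject≤ c (ℕ.≤-trans (ℕ.≤-reflexive (ℕ.+-comm d 1)) d<q)

  F : Fin (d ℕ.+ 1) → (Fin 2 → Fin q) → Fin k → Fin q
  F c a l = join (point (toℕ l)) (point (suc (toℕ l))) (scalar c) (a zero) (a (suc zero))

  -- The point shared by the two joins that form window `i`.
  center : Fin (suc k ℕ.∸ 2) → ℕ
  center i = suc (toℕ i)

  center< : ∀ i → center i ℕ.< 2 ℕ.* q ℕ.+ 4
  center< i = ℕ.≤-trans (ℕ.≤-reflexive (ℕ.+-comm 2 (toℕ i)))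
    (ℕ.≤-trans (start+t≤k k 2 i) (ℕ.+-monoʳ-≤ (2 ℕ.* q) (s≤s (s≤s (s≤s z≤n)))))

  -- By linearity both joins of the window vanish on the difference of the rows, and they vanish
  -- together only on multiples of the vector (1 , center).
  window-meet : ∀ i c c′ a a′ → (∀ (j : Fin 2) → F c a (column i j) ≡ F c′ a′ (column i j)) →
    (a zero - a′ zero) - (scalar c - scalar c′) · abscissa (center i) ≡ 0# ×
    (a (suc zero) - a′ (suc zero)) - (scalar c - scalar c′) · ordinate (center i) ≡ 0#
  window-meet i c c′ a a′ agree = joins-meet (point (toℕ i)) (point (center i)) (point (suc (center i))) _ _ _
    (noncollinear (toℕ i)) (vanish (toℕ i) zero (ℕ.+-identityʳ (toℕ i))) (vanish (center i) (suc zero) (ℕ.+-comm (toℕ i) 1))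
    where
    vanish : ∀ n (j : Fin 2) → toℕ i ℕ.+ toℕ j ≡ n →
      join (point n) (point (suc n)) (scalar c - scalar c′) (a zero - a′ zero) (a (suc zero) - a′ (suc zero)) ≡ 0#
    vanish n j eq = ≡.subst
      (λ n → join (point n) (point (suc n)) (scalar c - scalar c′) (a zero - a′ zero) (a (suc zero) - a′ (suc zero)) ≡ 0#)
      (≡.trans (toℕ-column {k} {2} i j) eq)
      (≡.trans (join-difference (point l) (point (suc l)) (scalar c) (scalar c′) _ _ _ _) (≡⇒difference≡0 (agree j)))
      where
      l : ℕ
      l = toℕ (column {k} {2} i j)

  block-injective : ∀ i c a a′ → (∀ (j : Fin 2) → F c a (column i j) ≡ F c a′ (column i j)) → ∀ l → a l ≡ a′ l
  block-injective i c a a′ agree = λ where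
      zero       → coordinate (proj₁ (window-meet i c c a a′ agree))
      (suc zero) → coordinate (proj₂ (window-meet i c c a a′ agree))
    where
    coordinate : ∀ {x y z} → (x - y) - (scalar c - scalar c) · z ≡ 0# → x ≡ y
    coordinate {z = z} eq = difference≡0⇒≡ (≡.trans (difference≡0⇒≡ eq) (zero-product z (-‿inverseʳ (scalar c))))

  -- The scalar difference multiplies two distinct centers to the same vector, hence is zero.
  blocks-separated : ∀ {i i′} → i ≢ i′ → ∀ c c′ a a′ →
    (∀ (j : Fin 2) → F c a (column i j) ≡ F c′ a′ (column i j)) →
    (∀ (j : Fin 2) → F c a (column i′ j) ≡ F c′ a′ (column i′ j)) → c ≡ c′
  blocks-separated {i} {i′} i≢i′ c c′ a a′ agree agree′ = inject≤-injective _ _ c c′ (difference≡0⇒≡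
    (common-multiple (λ eq → i≢i′ (toℕ-injective (ℕ.suc-injective (point-injective (center< i) (center< i′) eq))))
      (window-meet i c c′ a a′ agree) (window-meet i′ c c′ a a′ agree′)))

  optimum : OptimumCDA d 2 ((d ℕ.+ 1) ℕ.* q ℕ.^ 2) k q
  optimum = BlockArray.optimum F block-injective blocks-separated

open import Data.Nat.Base using (_+_; _*_; _∸_; _^_; _≤_; _<_)

mainTheorem9 : ∀ (q : ℕ) → IsPrimePower q →
    (∀ (d t : ℕ) → 1 ≤ d → 1 ≤ t → d < q → t + 1 < q →
    OptimumCDA d t ((d + 1) * q ^ t) (q + t ∸ 1) q)
    ×
    (4 ≤ q → IsPowerOf2 q → ∀ (d : ℕ) → 1 ≤ d → d < q →
    OptimumCDA d 2 ((d + 1) * q ^ 2) (2 * q + 3) q)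
mainTheorem9 q (p , e , pr , 1≤e , ≡.refl) =
  (λ d t _ 1≤t d<q t+1<q → PolynomialArray.optimum D d<q 1≤t (ℕ.<-trans (ℕ.≤-reflexive (ℕ.+-comm 1 t)) t+1<q)) ,
  (λ 4≤q _ d _ d<q → JoinArray.optimum D d<q 4≤q)
  where
  D : FiniteDomain (p ^ e)
  D = finiteDomain pr 1≤e
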